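{- For all integers $1\leq k\leq n$: (i) $A_{n,k}=B_{n,k}(A_{1,1},A_{2,1},\ldots,A_{n-k+1,1})$; (ii) $B_{n,k}=A_{n,k}(A_{1,1},A_{2,1},\ldots,A_{n-k+1,1})$.
   Context: Let $R=\mathbb{Z}[X_1,X_1^{ -1},X_2,X_3,\ldots]$. For $P\in R$ and $Y_1,Y_2,\ldots\in R$ with $Y_1$ a unit of $R$, $P(Y_1,Y_2,\ldots)$ denotes the image of $P$ under the ring homomorphism $X_i\mapsto Y_i$. Partial exponential Bell polynomials: $B_{0,0}=1$, $B_{n,0}=0$ for $n\geq1$, $B_{n,k}=0$ for $0\leq n<k$, and for $1\leq k\leq n$, $B_{n,k}=\sum \frac{n!}{r_1!\cdots r_{n-k+1}!\,(1!)^{r_1}\cdots((n-k+1)!)^{r_{n-k+1}}}X_1^{r_1}\cdots X_{n-k+1}^{r_{n-k+1}}$, summed over nonnegative integers $r_i$ with $\sum r_i=k$, $\sum i r_i=n$. Elements $S_{n,k}\in R$: $S_{0,0}=X_1^{ -1}$, $S_{n,0}=0$ ($n\geq1$), $S_{n,k}=0$ ($0\leq n<k$), and for $n\geq0$, $1\leq k\leq n+1$: $S_{n+1,k}=-(2n-1)X_2S_{n,k}+X_1\big(S_{n,k-1}+\sum_{j=1}^{n-k+1}X_{j+1}\,\partial S_{n,k}/\partial X_j\big)$. Set $A_{n,k}:=X_1^{ -(2n-1)}S_{n,k}$ (note $A_{1,1}=X_1^{ -1}$). -}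

module Defs where

open import Data.Nat as ℕ using (ℕ; zero; suc; _≤?_; _!; NonZero)
open import Data.Nat.Properties using (_!≢0; m*n≢0; m^n≢0)
open import Data.Nat.DivMod using (_/_)
open import Data.Integer as ℤ using (ℤ; +_; -[1+_])
open import Data.Bool using (Bool; true; false; if_then_else_; _∧_)
open import Data.List using (List; []; _∷_; _++_; map; concatMap; foldr; replicate; upTo; filterᵇ)
import Data.List as L
open import Data.List.Properties using (≡-dec)
open import Data.Product using (_×_; _,_)
open import Relation.Nullary.Decidable using (⌊_⌋; yes; no)
open import Relation.Binary.PropositionalEquality using (_≡_; refl)

-- The ring R = ℤ[X₁, X₁⁻¹, X₂, X₃, …]
--
-- A monomial X₁^e · X₂^(a₀) · X₃^(a₁) ⋯ is given by e : ℤ and the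
-- (finite) list of exponents [a₀, a₁, …] of X₂, X₃, … (missing entries
-- and trailing zeros mean exponent 0).

record Mono : Set where
  constructor mono
  field
    e₁ : ℤ
    es : List ℕ

consZ : ℕ → List ℕ → List ℕ
consZ zero [] = []
consZ x ys = x ∷ ys

strip : List ℕ → List ℕ
strip [] = []
strip (x ∷ xs) = consZ x (strip xs)

sameMono : Mono → Mono → Bool
sameMono (mono e xs) (mono f ys) = ⌊ e ℤ.≟ f ⌋ ∧ ⌊ ≡-dec ℕ._≟_ (strip xs) (strip ys) ⌋

addExp : List ℕ → List ℕ → List ℕ
addExp [] ys = ys
addExp (x ∷ xs) [] = x ∷ xs
addExp (x ∷ xs) (y ∷ ys) = (x ℕ.+ y) ∷ addExp xs ys

mulMono : Mono → Mono → Mono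
mulMono (mono e xs) (mono f ys) = mono (e ℤ.+ f) (addExp xs ys)

-- An element of R: a finite formal ℤ-linear combination of monomials.
R : Set
R = List (ℤ × Mono)

coeff : R → Mono → ℤ
coeff [] m = + 0
coeff ((c , m') ∷ p) m = (if sameMono m' m then c else + 0) ℤ.+ coeff p m

infix 4 _≈_
_≈_ : R → R → Set
p ≈ q = ∀ m → coeff p m ≡ coeff q m

0R : R
0R = []

const : ℤ → R
const c = (c , mono (+ 0) []) ∷ []

1R : R
1R = const (+ 1)

infixl 6 _+R_
infixl 7 _*R_
_+R_ : R → R → R
p +R q = p ++ q

-R_ : R → R
-R p = map (λ { (c , m) → (ℤ.- c , m) }) p

_*R_ : R → R → R
p *R q = concatMap (λ { (c , m) → map (λ { (d , m') → (c ℤ.* d , mulMono m m') }) q }) p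

_^R_ : R → ℕ → R
p ^R zero = 1R
p ^R suc n = p *R (p ^R n)

-- the variables X i (i ≥ 1); X 0 is unused and set to 0
X : ℕ → R
X zero = 0R
X (suc zero) = (+ 1 , mono (+ 1) []) ∷ []
X (suc (suc i)) = (+ 1 , mono (+ 0) (replicate i 0 ++ (1 ∷ []))) ∷ []

X₁^ : ℤ → R
X₁^ e = (+ 1 , mono e []) ∷ []

ΣR : ℕ → (ℕ → R) → R
ΣR zero f = 0R
ΣR (suc m) f = ΣR m f +R f (suc m)

lookup0 : List ℕ → ℕ → ℕ
lookup0 [] i = 0
lookup0 (x ∷ xs) zero = x
lookup0 (x ∷ xs) (suc i) = lookup0 xs i

decAt : ℕ → List ℕ → List ℕ
decAt i [] = []
decAt zero (x ∷ xs) = (x ℕ.∸ 1) ∷ xs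
decAt (suc i) (x ∷ xs) = x ∷ decAt i xs

∂ : ℕ → R → R
∂ zero p = 0R
∂ (suc zero) p = map (λ { (c , mono e es) → (c ℤ.* e , mono (e ℤ.- + 1) es) }) p
∂ (suc (suc i)) p = map (λ { (c , mono e es) → (c ℤ.* + lookup0 es i , mono e (decAt i es)) }) p

-- Substitution  P ↦ P(Y₁, Y₂, …)  (the ring homomorphism X_i ↦ Y_i),
-- where Y₁ is a unit of R with given inverse Y₁⁻¹.

module _ (Y : ℕ → R) (Y₁⁻¹ : R) where

  pow₁ : ℤ → R
  pow₁ (+ n) = Y 1 ^R n
  pow₁ -[1+ n ] = Y₁⁻¹ ^R suc n

  powRest : ℕ → List ℕ → R
  powRest i [] = 1R
  powRest i (a ∷ as) = (Y i ^R a) *R powRest (suc i) as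

  evalMono : Mono → R
  evalMono (mono e es) = pow₁ e *R powRest 2 es

  evalWith : R → R
  evalWith p = foldr (λ { (c , m) acc → (const c *R evalMono m) +R acc }) 0R p

substR : (P : R) (Y : ℕ → R) (Y₁⁻¹ : R) → Y 1 *R Y₁⁻¹ ≈ 1R → R
substR P Y Y₁⁻¹ _ = evalWith Y Y₁⁻¹ P

tuples : ℕ → ℕ → List (List ℕ)
tuples zero b = [] ∷ []
tuples (suc m) b = concatMap (λ r → map (r ∷_) (tuples m b)) (upTo (suc b))

sumL : List ℕ → ℕ
sumL = foldr ℕ._+_ 0

wsum : ℕ → List ℕ → ℕ
wsum i [] = 0
wsum i (r ∷ rs) = i ℕ.* r ℕ.+ wsum (suc i) rs

denom : ℕ → List ℕ → ℕ
denom i [] = 1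
denom i (r ∷ rs) = (r ! ℕ.* ((i !) ℕ.^ r)) ℕ.* denom (suc i) rs

denom≢0 : ∀ i rs → NonZero (denom i rs)
denom≢0 i [] = _
denom≢0 i (r ∷ rs) =
  m*n≢0 _ _ {{m*n≢0 _ _ {{r !≢0}} {{m^n≢0 (i !) r {{i !≢0}}}}}} {{denom≢0 (suc i) rs}}

monoOf : List ℕ → Mono
monoOf [] = mono (+ 0) []
monoOf (r ∷ rs) = mono (+ r) rs

bellTerm : ℕ → List ℕ → R
bellTerm n rs = (+ ((n !) / denom 1 rs) {{denom≢0 1 rs}} , monoOf rs) ∷ []

B : ℕ → ℕ → R
B zero zero = 1R
B (suc n) zero = 0R
B n (suc k) with suc k ≤? n
... | no _ = 0R
... | yes _ =
  let rss = filterᵇ (λ rs → (sumL rs ℕ.≡ᵇ suc k) ∧ (wsum 1 rs ℕ.≡ᵇ n)) (tuples (n ℕ.∸ suc k ℕ.+ 1) (suc k))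
  in foldr (λ rs acc → bellTerm n rs +R acc) 0R rss

S : ℕ → ℕ → R
S zero zero = X₁^ (ℤ.- + 1)
S zero (suc k) = 0R
S (suc n) zero = 0R
S (suc n) (suc k) with suc k ≤? suc n
... | no _ = 0R
... | yes _ =
  (const (ℤ.- (+ (2 ℕ.* n) ℤ.- + 1)) *R X 2 *R S n (suc k))
  +R X 1 *R (S n k +R ΣR (n ℕ.∸ suc k ℕ.+ 1) (λ j → X (suc j) *R ∂ j (S n (suc k))))

A : ℕ → ℕ → R
A n k = X₁^ (ℤ.- (+ (2 ℕ.* n) ℤ.- + 1)) *R S n k

A₁₁-unit : A 1 1 *R X 1 ≈ 1R
A₁₁-unit m = refl

{-# OPTIONS --safe #-}
module Submission where

-- Let D be the derivation of R with D X_i = X_{i+1} for all i ≥ 1. The recursion for S turns into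
-- A_{n+1,k} = X₁⁻¹ (A_{n,k-1} + D A_{n,k}), and the Bell polynomials satisfy B_{n+1,k} = X₁ B_{n,k-1} + D B_{n,k}.
-- In particular X₁⁻¹ D A_{i,1} = A_{i+1,1}, so the substitution φ : X_i ↦ A_{i,1} satisfies φ D = X₁⁻¹ D φ
-- (both sides are derivations along φ that agree on the generators). Hence φ carries the recursion for B
-- to the one for A, which is (i). Moreover φ (A_{i+1,1}) = φ (X₁⁻¹) φ (D A_{i,1}) = D φ (A_{i,1}), so that
-- φ (A_{i,1}) = X_i by induction; thus φ is an involution and (ii) follows from (i).

open import Defs
open import Algebra.Bundles using (CommutativeRing)
import Algebra.Solver.Ring.NaturalCoefficients.Default as NatSolver
open import Data.Bool using (Bool; true; false; if_then_else_; _∧_)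
open import Data.Integer using (ℤ; +_; -[1+_]; _+_; _*_; -_; _-_; _⊖_)
import Data.Integer as ℤ
import Data.Integer.Properties as ℤ
open import Algebra.Properties.AbelianGroup ℤ.+-0-abelianGroup using (∙-cancelˡ)
open import Data.Integer.Tactic.RingSolver using (solve-∀)
open import Data.List using (List; []; _∷_; _++_; map; concatMap; foldr; replicate; length; filterᵇ; upTo; applyUpTo)
open import Data.List.Properties using (≡-dec; ∷-injectiveˡ; ∷-injectiveʳ)
open import Data.Nat using (ℕ; zero; suc; _≤_; _<_; z≤n; s≤s; _!)
import Data.Nat as ℕ
open import Data.Nat.DivMod using (_/_; m*n/n≡m)
import Data.Nat.Properties as ℕ
import Data.Nat.Tactic.RingSolver as ℕ-Solver
open import Data.Product using (_×_; _,_; proj₁; proj₂)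
open import Level using (0ℓ)
open import Relation.Binary using (IsEquivalence)
open import Relation.Binary.PropositionalEquality using (_≡_; refl; sym; trans; cong; cong₂; subst; subst₂; module ≡-Reasoning)
import Relation.Binary.Reasoning.Setoid as SetoidReasoning
open import Relation.Nullary using (¬_; yes; no; contradiction)
open import Relation.Nullary.Reflects using (Reflects; ofʸ; ofⁿ; det; fromEquivalence; _×-reflects_)

open ≡-Reasoning

-- Monomials

-- An element of `R` is a list of terms in which a monomial may occur repeatedly and in several
-- spellings, so equal elements can be very different lists. Equality is therefore tested by linear
-- functionals: if `f` is constant on equivalent monomials, `lin f` depends only on the coefficients
-- (`lin-cong`), and the functionals `δ m` recover the coefficients (`lin-≈`). Products, derivatives
-- and substitutions act on `lin f` by changing `f`, which reduces their laws to statements about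
-- monomials.
--
-- Two gaps lie between the definitions and the algebra. The sum in the recursion for `S` stops at
-- `n - k + 1`, whereas a derivation needs the whole sum; `bound-S` shows that the missing partial
-- derivatives vanish. And `B` is a closed sum with truncating quotients, whereas the argument needs
-- a recursion; `bell` is defined by the recursion, and its coefficients times the denominators are
-- shown to be `n !` or 0.

infix 4 _≐_ _≋_

-- Equality up to trailing zeros. The pointwise form is the one to reason with; `strip` supplies the
-- canonical form on which `sameMono` decides the same relation.
_≐_ : List ℕ → List ℕ → Set
xs ≐ ys = ∀ i → lookup0 xs i ≡ lookup0 ys i

record _≋_ (m m' : Mono) : Set where
  constructor _,_
  field
    e₁-≡ : Mono.e₁ m ≡ Mono.e₁ m'
    es-≐ : Mono.es m ≐ Mono.es m'

open _≋_

≋-refl : ∀ {m} → m ≋ m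
≋-refl = refl , λ _ → refl

≋-sym : ∀ {m m'} → m ≋ m' → m' ≋ m
≋-sym (p , q) = sym p , λ i → sym (q i)

≋-trans : ∀ {m m' m''} → m ≋ m' → m' ≋ m'' → m ≋ m''
≋-trans (p , q) (p' , q') = trans p p' , λ i → trans (q i) (q' i)

consZ-lookup : ∀ x xs → consZ x xs ≐ (x ∷ xs)
consZ-lookup zero [] zero = refl
consZ-lookup zero [] (suc i) = refl
consZ-lookup zero (y ∷ ys) i = refl
consZ-lookup (suc x) xs i = refl

strip-≐ : ∀ xs → strip xs ≐ xs
strip-≐ [] i = refl
strip-≐ (x ∷ xs) zero = consZ-lookup x (strip xs) zero
strip-≐ (x ∷ xs) (suc i) = trans (consZ-lookup x (strip xs) (suc i)) (strip-≐ xs i)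

strip-zero : ∀ xs → xs ≐ [] → strip xs ≡ []
strip-zero [] _ = refl
strip-zero (x ∷ xs) h = cong₂ consZ (h 0) (strip-zero xs (λ i → h (suc i)))

strip-cong : ∀ xs ys → xs ≐ ys → strip xs ≡ strip ys
strip-cong [] ys h = sym (strip-zero ys (λ i → sym (h i)))
strip-cong (x ∷ xs) [] h = strip-zero (x ∷ xs) h
strip-cong (x ∷ xs) (y ∷ ys) h = cong₂ consZ (h 0) (strip-cong xs ys (λ i → h (suc i)))

strip-injective : ∀ xs ys → strip xs ≡ strip ys → xs ≐ ys
strip-injective xs ys e i = begin
  lookup0 xs i         ≡⟨ strip-≐ xs i ⟨
  lookup0 (strip xs) i ≡⟨ cong (λ zs → lookup0 zs i) e ⟩
  lookup0 (strip ys) i ≡⟨ strip-≐ ys i ⟩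
  lookup0 ys i         ∎

sameMono-reflects : ∀ m m' → Reflects (m ≋ m') (sameMono m m')
sameMono-reflects (mono e xs) (mono f ys)
  with e ℤ.≟ f | ≡-dec ℕ._≟_ (strip xs) (strip ys)
... | no ¬p | _ = ofⁿ λ h → ¬p (e₁-≡ h)
... | yes _ | no ¬q = ofⁿ λ h → ¬q (strip-cong xs ys (es-≐ h))
... | yes p | yes q = ofʸ (p , strip-injective xs ys q)

sameMono-congˡ : ∀ {m m' n} → m ≋ m' → sameMono m n ≡ sameMono m' n
sameMono-congˡ {m} {m'} {n} h with sameMono m n | sameMono-reflects m n
... | _ | ofʸ a = det (ofʸ (≋-trans (≋-sym h) a)) (sameMono-reflects m' n)
... | _ | ofⁿ a = det (ofⁿ λ b → a (≋-trans h b)) (sameMono-reflects m' n)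

lookup-addExp : ∀ xs ys i → lookup0 (addExp xs ys) i ≡ lookup0 xs i ℕ.+ lookup0 ys i
lookup-addExp [] ys i = refl
lookup-addExp (x ∷ xs) [] i = sym (ℕ.+-identityʳ _)
lookup-addExp (x ∷ xs) (y ∷ ys) zero = refl
lookup-addExp (x ∷ xs) (y ∷ ys) (suc i) = lookup-addExp xs ys i

mulMono-cong : ∀ {m m' n n'} → m ≋ m' → n ≋ n' → mulMono m n ≋ mulMono m' n'
mulMono-cong {mono _ xs} {mono _ xs'} {mono _ ys} {mono _ ys'} (p , q) (p' , q') =
  cong₂ _+_ p p' , λ i → begin
    lookup0 (addExp xs ys) i         ≡⟨ lookup-addExp xs ys i ⟩
    lookup0 xs i ℕ.+ lookup0 ys i    ≡⟨ cong₂ ℕ._+_ (q i) (q' i) ⟩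
    lookup0 xs' i ℕ.+ lookup0 ys' i  ≡⟨ lookup-addExp xs' ys' i ⟨
    lookup0 (addExp xs' ys') i       ∎

mulMono-comm : ∀ m n → mulMono m n ≋ mulMono n m
mulMono-comm (mono e xs) (mono f ys) = ℤ.+-comm e f , λ i → begin
  lookup0 (addExp xs ys) i       ≡⟨ lookup-addExp xs ys i ⟩
  lookup0 xs i ℕ.+ lookup0 ys i  ≡⟨ ℕ.+-comm (lookup0 xs i) _ ⟩
  lookup0 ys i ℕ.+ lookup0 xs i  ≡⟨ lookup-addExp ys xs i ⟨
  lookup0 (addExp ys xs) i       ∎

mulMono-assoc : ∀ m n o → mulMono (mulMono m n) o ≋ mulMono m (mulMono n o)
mulMono-assoc (mono e xs) (mono f ys) (mono g zs) = ℤ.+-assoc e f g , λ i → begin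
  lookup0 (addExp (addExp xs ys) zs) i                ≡⟨ lookup-addExp (addExp xs ys) zs i ⟩
  lookup0 (addExp xs ys) i ℕ.+ lookup0 zs i           ≡⟨ cong (ℕ._+ _) (lookup-addExp xs ys i) ⟩
  lookup0 xs i ℕ.+ lookup0 ys i ℕ.+ lookup0 zs i      ≡⟨ ℕ.+-assoc (lookup0 xs i) _ _ ⟩
  lookup0 xs i ℕ.+ (lookup0 ys i ℕ.+ lookup0 zs i)    ≡⟨ cong (lookup0 xs i ℕ.+_) (lookup-addExp ys zs i) ⟨
  lookup0 xs i ℕ.+ lookup0 (addExp ys zs) i           ≡⟨ lookup-addExp xs (addExp ys zs) i ⟨
  lookup0 (addExp xs (addExp ys zs)) i                ∎

1M : Mono
1M = mono (+ 0) []

mulMono-identityˡ : ∀ m → mulMono 1M m ≋ m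
mulMono-identityˡ (mono e xs) = ℤ.+-identityˡ e , λ _ → refl

-- Linear functionals

-- The freedom in `f` is the point: `coeff` alone does not pass through products or derivatives, but
-- `lin f` does, with another functional in place of `f`.
lin : (Mono → ℤ) → R → ℤ
lin f [] = + 0
lin f ((c , m) ∷ p) = c * f m + lin f p

Respects : (Mono → ℤ) → Set
Respects f = ∀ m m' → m ≋ m' → f m ≡ f m'

δ : Mono → Mono → ℤ
δ m₀ m = if sameMono m m₀ then + 1 else + 0

δ-respects : ∀ m₀ → Respects (δ m₀)
δ-respects m₀ m m' h = cong (if_then + 1 else + 0) (sameMono-congˡ {n = m₀} h)

if-scale : ∀ b c → (if b then c else + 0) ≡ c * (if b then + 1 else + 0)
if-scale true c = sym (ℤ.*-identityʳ c)
if-scale false c = sym (ℤ.*-zeroʳ c)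

coeff-lin : ∀ p m → coeff p m ≡ lin (δ m) p
coeff-lin [] m = refl
coeff-lin ((c , m') ∷ p) m = cong₂ _+_ (if-scale (sameMono m' m) c) (coeff-lin p m)

lin-ext : ∀ {f g} → (∀ m → f m ≡ g m) → ∀ p → lin f p ≡ lin g p
lin-ext h [] = refl
lin-ext h ((c , m) ∷ p) = cong₂ _+_ (cong (c *_) (h m)) (lin-ext h p)

lin-++ : ∀ f p q → lin f (p ++ q) ≡ lin f p + lin f q
lin-++ f [] q = sym (ℤ.+-identityˡ _)
lin-++ f ((c , m) ∷ p) q = trans (cong (_+_ (c * f m)) (lin-++ f p q)) (sym (ℤ.+-assoc (c * f m) _ _))

lin-scale : ∀ a f p → lin (λ m → a * f m) p ≡ a * lin f p
lin-scale a f [] = sym (ℤ.*-zeroʳ a)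
lin-scale a f ((c , m) ∷ p) = trans (cong (_+_ (c * (a * f m))) (lin-scale a f p)) (step c a (f m) (lin f p))
  where
  step : ∀ c a x y → c * (a * x) + a * y ≡ a * (c * x + y)
  step = solve-∀

lin-+ : ∀ f g p → lin (λ m → f m + g m) p ≡ lin f p + lin g p
lin-+ f g [] = refl
lin-+ f g ((c , m) ∷ p) = trans (cong (_+_ (c * (f m + g m))) (lin-+ f g p)) (step c (f m) (g m) (lin f p) (lin g p))
  where
  step : ∀ c x y u v → c * (x + y) + (u + v) ≡ (c * x + u) + (c * y + v)
  step = solve-∀

lin-0 : ∀ p → lin (λ _ → + 0) p ≡ + 0
lin-0 [] = refl
lin-0 ((c , m) ∷ p) = cong₂ _+_ (ℤ.*-zeroʳ c) (lin-0 p)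

lin-neg : ∀ f p → lin f (-R p) ≡ - lin f p
lin-neg f [] = refl
lin-neg f ((c , m) ∷ p) = trans (cong (_+_ (- c * f m)) (lin-neg f p)) (step c (f m) (lin f p))
  where
  step : ∀ c x y → - c * x + - y ≡ - (c * x + y)
  step = solve-∀

-- Interchange of two finite sums. Commutativity of the product and multiplicativity of substitution
-- rest on it.
lin-swap : ∀ (g : Mono → Mono → ℤ) p q →
  lin (λ m → lin (g m) q) p ≡ lin (λ n → lin (λ m → g m n) p) q
lin-swap g [] q = sym (lin-0 q)
lin-swap g ((c , m) ∷ p) q = begin
  c * lin (g m) q + lin (λ m → lin (g m) q) p
    ≡⟨ cong₂ _+_ (sym (lin-scale c (g m) q)) (lin-swap g p q) ⟩
  lin (λ n → c * g m n) q + lin (λ n → lin (λ m → g m n) p) q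
    ≡⟨ lin-+ (λ n → c * g m n) (λ n → lin (λ m → g m n) p) q ⟨
  lin (λ n → c * g m n + lin (λ m → g m n) p) q ∎

lin-map : ∀ (c : ℤ) (h : Mono → Mono) {g : ℤ × Mono → ℤ × Mono} f →
  (∀ d m → g (d , m) ≡ (c * d , h m)) → ∀ q → lin f (map g q) ≡ c * lin (λ m → f (h m)) q
lin-map c h f e [] = sym (ℤ.*-zeroʳ c)
lin-map c h {g} f e ((d , m) ∷ q) = begin
  lin f (g (d , m) ∷ map g q)
    ≡⟨ cong₂ (λ t u → proj₁ t * f (proj₂ t) + u) (e d m) (lin-map c h f e q) ⟩
  c * d * f (h m) + c * lin (λ m → f (h m)) q
    ≡⟨ step c d (f (h m)) _ ⟩
  c * (d * f (h m) + lin (λ m → f (h m)) q) ∎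
  where
  step : ∀ c d x y → c * d * x + c * y ≡ c * (d * x + y)
  step = solve-∀

lin-* : ∀ f p q → lin f (p *R q) ≡ lin (λ m → lin (λ n → f (mulMono m n)) q) p
lin-* f [] q = refl
lin-* f ((c , m) ∷ p) q =
  trans (lin-++ f (map _ q) (p *R q)) (cong₂ _+_ (lin-map c (mulMono m) f (λ _ _ → refl) q) (lin-* f p q))

-- Collecting all occurrences of one monomial at once replaces a normal form for formal sums: a list
-- whose coefficients all vanish can be emptied one monomial at a time.
remove : Mono → R → R
remove m [] = []
remove m ((c , m') ∷ p) = if sameMono m' m then remove m p else (c , m') ∷ remove m p

length-remove : ∀ m p → length (remove m p) ≤ length p
length-remove m [] = z≤n
length-remove m ((c , m') ∷ p) with sameMono m' m
... | true = ℕ.m≤n⇒m≤1+n (length-remove m p)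
... | false = s≤s (length-remove m p)

remove-head : ∀ c m p → remove m ((c , m) ∷ p) ≡ remove m p
remove-head c m p with sameMono m m | sameMono-reflects m m
... | true | _ = refl
... | false | ofⁿ h = contradiction (≋-refl {m}) h

lin-remove : ∀ {f} → Respects f → ∀ m p → lin f p ≡ coeff p m * f m + lin f (remove m p)
lin-remove r m [] = refl
lin-remove {f} r m ((c , m') ∷ p) with sameMono m' m | sameMono-reflects m' m
... | true | ofʸ h = trans (cong₂ _+_ (cong (c *_) (r _ _ h)) (lin-remove r m p)) (step c (coeff p m) (f m) _)
  where
  step : ∀ c d x y → c * x + (d * x + y) ≡ (c + d) * x + y
  step = solve-∀
... | false | _ = trans (cong (_+_ (c * f m')) (lin-remove r m p)) (step (c * f m') (coeff p m) (f m) _)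
  where
  step : ∀ c d x y → c + (d * x + y) ≡ (+ 0 + d) * x + (c + y)
  step = solve-∀

coeff-remove-same : ∀ {m m₀} → m ≋ m₀ → ∀ p → coeff (remove m p) m₀ ≡ + 0
coeff-remove-same h [] = refl
coeff-remove-same {m} {m₀} h ((c , m') ∷ p) with sameMono m' m | sameMono-reflects m' m
... | true | _ = coeff-remove-same h p
... | false | ofⁿ k with sameMono m' m₀ | sameMono-reflects m' m₀
...   | true | ofʸ l = contradiction (≋-trans l (≋-sym h)) k
...   | false | _ = trans (ℤ.+-identityˡ _) (coeff-remove-same h p)

coeff-remove-other : ∀ {m m₀} → ¬ m ≋ m₀ → ∀ p → coeff (remove m p) m₀ ≡ coeff p m₀
coeff-remove-other h [] = refl
coeff-remove-other {m} {m₀} h ((c , m') ∷ p) with sameMono m' m | sameMono-reflects m' m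
... | false | _ = cong (_+_ (if sameMono m' m₀ then c else + 0)) (coeff-remove-other h p)
... | true | ofʸ k with sameMono m' m₀ | sameMono-reflects m' m₀
...   | true | ofʸ l = contradiction (≋-trans (≋-sym k) l) h
...   | false | _ = trans (coeff-remove-other h p) (sym (ℤ.+-identityˡ _))

coeff-remove-zero : ∀ p → p ≈ 0R → ∀ m → remove m p ≈ 0R
coeff-remove-zero p p≈0 m m₀ with sameMono m m₀ | sameMono-reflects m m₀
... | _ | ofʸ h = coeff-remove-same h p
... | _ | ofⁿ h = trans (coeff-remove-other h p) (p≈0 m₀)

-- Induction on a bound `k` for the length: `remove m p` is not structurally smaller than `p`, but
-- it is shorter, because the head of `p` carries `m`. The removed terms contribute
-- `coeff p m * f m`, which is zero.
lin-zero : ∀ {f} → Respects f → ∀ k p → length p ≤ k → p ≈ 0R → lin f p ≡ + 0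
lin-zero r k [] _ _ = refl
lin-zero {f} r (suc k) p@((c , m) ∷ p') (s≤s l) p≈0 = begin
  lin f p                              ≡⟨ lin-remove r m p ⟩
  coeff p m * f m + lin f (remove m p) ≡⟨ cong₂ (λ x y → x * f m + y) (p≈0 m) tail≡0 ⟩
  + 0 * f m + + 0                      ≡⟨⟩
  + 0                                  ∎
  where
  tail≡0 : lin f (remove m p) ≡ + 0
  tail≡0 = lin-zero r k (remove m p)
    (subst (λ q → length q ≤ k) (sym (remove-head c m p')) (ℕ.≤-trans (length-remove m p') l))
    (coeff-remove-zero p p≈0 m)

-- By linearity only the difference of the two lists has to be treated, and all its coefficients
-- vanish.
lin-cong : ∀ {f} → Respects f → ∀ p q → p ≈ q → lin f p ≡ lin f q
lin-cong {f} r p q p≈q = ℤ.i-j≡0⇒i≡j _ _ (trans (sym (lin-diff f)) (lin-zero r _ d ℕ.≤-refl d≈0))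
  where
  d = p ++ -R q
  lin-diff : ∀ g → lin g d ≡ lin g p - lin g q
  lin-diff g = trans (lin-++ g p (-R q)) (cong (_+_ (lin g p)) (lin-neg g q))
  d≈0 : d ≈ 0R
  d≈0 m = begin
    coeff d m                     ≡⟨ coeff-lin d m ⟩
    lin (δ m) d                   ≡⟨ lin-diff (δ m) ⟩
    lin (δ m) p - lin (δ m) q     ≡⟨ cong₂ _-_ (sym (coeff-lin p m)) (sym (coeff-lin q m)) ⟩
    coeff p m - coeff q m         ≡⟨ cong (_- coeff q m) (p≈q m) ⟩
    coeff q m - coeff q m         ≡⟨ ℤ.+-inverseʳ (coeff q m) ⟩
    + 0                           ∎

lin-≈ : ∀ p q → (∀ {f} → Respects f → lin f p ≡ lin f q) → p ≈ q
lin-≈ p q h m = trans (coeff-lin p m) (trans (h (δ-respects m)) (sym (coeff-lin q m)))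

-- R is a commutative ring

mulMono-respectsˡ : ∀ {f} → Respects f → ∀ n → Respects (λ m → f (mulMono m n))
mulMono-respectsˡ r n _ _ h = r _ _ (mulMono-cong h ≋-refl)

mulMono-respectsʳ : ∀ {f} → Respects f → ∀ m → Respects (λ n → f (mulMono m n))
mulMono-respectsʳ r m _ _ h = r _ _ (mulMono-cong (≋-refl {m}) h)

lin-mul-respects : ∀ {f} → Respects f → ∀ q → Respects (λ m → lin (λ n → f (mulMono m n)) q)
lin-mul-respects r q _ _ h = lin-ext (λ n → mulMono-respectsˡ r n _ _ h) q

≈-isEquivalence : IsEquivalence _≈_
≈-isEquivalence = record
  { refl = λ _ → refl ; sym = λ h m → sym (h m) ; trans = λ h k m → trans (h m) (k m) }

+R-cong : ∀ p p' q q' → p ≈ p' → q ≈ q' → p +R q ≈ p' +R q'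
+R-cong p p' q q' h k = lin-≈ (p +R q) (p' +R q') λ {f} r →
  trans (lin-++ f p q) (trans (cong₂ _+_ (lin-cong r p p' h) (lin-cong r q q' k)) (sym (lin-++ f p' q')))

+R-assoc : ∀ p q s → (p +R q) +R s ≈ p +R (q +R s)
+R-assoc p q s = lin-≈ ((p +R q) +R s) (p +R (q +R s)) λ {f} r → begin
  lin f ((p ++ q) ++ s)           ≡⟨ lin-++ f (p ++ q) s ⟩
  lin f (p ++ q) + lin f s        ≡⟨ cong (_+ lin f s) (lin-++ f p q) ⟩
  lin f p + lin f q + lin f s     ≡⟨ ℤ.+-assoc (lin f p) _ _ ⟩
  lin f p + (lin f q + lin f s)   ≡⟨ cong (_+_ (lin f p)) (lin-++ f q s) ⟨
  lin f p + lin f (q ++ s)        ≡⟨ lin-++ f p (q ++ s) ⟨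
  lin f (p ++ (q ++ s))           ∎

+R-comm : ∀ p q → p +R q ≈ q +R p
+R-comm p q = lin-≈ (p +R q) (q +R p) λ {f} r →
  trans (lin-++ f p q) (trans (ℤ.+-comm (lin f p) _) (sym (lin-++ f q p)))

-R-cong : ∀ p q → p ≈ q → -R p ≈ -R q
-R-cong p q h = lin-≈ (-R p) (-R q) λ {f} r →
  trans (lin-neg f p) (trans (cong -_ (lin-cong r p q h)) (sym (lin-neg f q)))

-R-inverseˡ : ∀ p → -R p +R p ≈ 0R
-R-inverseˡ p = lin-≈ (-R p +R p) 0R λ {f} r →
  trans (lin-++ f (-R p) p) (trans (cong (_+ lin f p) (lin-neg f p)) (ℤ.+-inverseˡ (lin f p)))

*R-comm : ∀ p q → p *R q ≈ q *R p
*R-comm p q = lin-≈ (p *R q) (q *R p) λ {f} r → begin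
  lin f (p *R q)                                    ≡⟨ lin-* f p q ⟩
  lin (λ m → lin (λ n → f (mulMono m n)) q) p       ≡⟨ lin-swap (λ m n → f (mulMono m n)) p q ⟩
  lin (λ n → lin (λ m → f (mulMono m n)) p) q
    ≡⟨ lin-ext (λ n → lin-ext (λ m → r _ _ (mulMono-comm m n)) p) q ⟩
  lin (λ n → lin (λ m → f (mulMono n m)) p) q       ≡⟨ lin-* f q p ⟨
  lin f (q *R p)                                    ∎

*R-congʳ : ∀ p p' q → p ≈ p' → p *R q ≈ p' *R q
*R-congʳ p p' q h = lin-≈ (p *R q) (p' *R q) λ {f} r →
  trans (lin-* f p q) (trans (lin-cong (lin-mul-respects r q) p p' h) (sym (lin-* f p' q)))

*R-cong : ∀ p p' q q' → p ≈ p' → q ≈ q' → p *R q ≈ p' *R q'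
*R-cong p p' q q' h k m = begin
  coeff (p *R q) m   ≡⟨ *R-congʳ p p' q h m ⟩
  coeff (p' *R q) m  ≡⟨ *R-comm p' q m ⟩
  coeff (q *R p') m  ≡⟨ *R-congʳ q q' p' k m ⟩
  coeff (q' *R p') m ≡⟨ *R-comm q' p' m ⟩
  coeff (p' *R q') m ∎

*R-assoc : ∀ p q s → (p *R q) *R s ≈ p *R (q *R s)
*R-assoc p q s = lin-≈ ((p *R q) *R s) (p *R (q *R s)) λ {f} r → begin
  lin f ((p *R q) *R s)
    ≡⟨ lin-* f (p *R q) s ⟩
  lin (λ m → lin (λ n → f (mulMono m n)) s) (p *R q)
    ≡⟨ lin-* (λ m → lin (λ n → f (mulMono m n)) s) p q ⟩
  lin (λ m → lin (λ n → lin (λ o → f (mulMono (mulMono m n) o)) s) q) p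
    ≡⟨ lin-ext (λ m → lin-ext (λ n → lin-ext (λ o → r _ _ (mulMono-assoc m n o)) s) q) p ⟩
  lin (λ m → lin (λ n → lin (λ o → f (mulMono m (mulMono n o))) s) q) p
    ≡⟨ lin-ext (λ m → lin-* (λ n → f (mulMono m n)) q s) p ⟨
  lin (λ m → lin (λ n → f (mulMono m n)) (q *R s)) p
    ≡⟨ lin-* f p (q *R s) ⟨
  lin f (p *R (q *R s)) ∎

lin-const* : ∀ {f} → Respects f → ∀ c p → lin f (const c *R p) ≡ c * lin f p
lin-const* {f} r c p = begin
  lin f (const c *R p)                              ≡⟨ lin-* f (const c) p ⟩
  c * lin (λ n → f (mulMono 1M n)) p + + 0          ≡⟨ ℤ.+-identityʳ _ ⟩
  c * lin (λ n → f (mulMono 1M n)) p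
    ≡⟨ cong (c *_) (lin-ext (λ n → r _ _ (mulMono-identityˡ n)) p) ⟩
  c * lin f p                                       ∎

*R-identityˡ : ∀ p → 1R *R p ≈ p
*R-identityˡ p = lin-≈ (1R *R p) p λ r → trans (lin-const* r (+ 1) p) (ℤ.*-identityˡ _)

*R-distribʳ : ∀ s p q → (p +R q) *R s ≈ p *R s +R q *R s
*R-distribʳ s p q = lin-≈ ((p +R q) *R s) (p *R s +R q *R s) λ {f} r →
  let g = λ m → lin (λ n → f (mulMono m n)) s in begin
  lin f ((p ++ q) *R s)              ≡⟨ lin-* f (p ++ q) s ⟩
  lin g (p ++ q)                     ≡⟨ lin-++ g p q ⟩
  lin g p + lin g q                  ≡⟨ cong₂ _+_ (lin-* f p s) (lin-* f q s) ⟨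
  lin f (p *R s) + lin f (q *R s)    ≡⟨ lin-++ f (p *R s) (q *R s) ⟨
  lin f (p *R s ++ q *R s)           ∎

commutativeRing : CommutativeRing 0ℓ 0ℓ
commutativeRing = record
  { Carrier = R ; _≈_ = _≈_ ; _+_ = _+R_ ; _*_ = _*R_ ; -_ = -R_ ; 0# = 0R ; 1# = 1R
  ; isCommutativeRing = record
    { isRing = record
      { +-isAbelianGroup = record
        { isGroup = record
          { isMonoid = record
            { isSemigroup = record
              { isMagma = record { isEquivalence = ≈-isEquivalence ; ∙-cong = λ {p} {p'} {q} {q'} → +R-cong p p' q q' }
              ; assoc = +R-assoc }
            ; identity = (λ p m → refl) , λ p → +R-comm p 0R }
          ; inverse = -R-inverseˡ , λ p m → trans (+R-comm p (-R p) m) (-R-inverseˡ p m)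
          ; ⁻¹-cong = λ {p} {q} → -R-cong p q }
        ; comm = +R-comm }
      ; *-cong = λ {p} {p'} {q} {q'} → *R-cong p p' q q'
      ; *-assoc = *R-assoc
      ; *-identity = *R-identityˡ , λ p m → trans (*R-comm p 1R m) (*R-identityˡ p m)
      ; distrib = (λ s p q m → trans (*R-comm s (p +R q) m) (trans (*R-distribʳ s p q m)
                    (+R-cong (p *R s) (s *R p) (q *R s) (s *R q) (*R-comm p s) (*R-comm q s) m)))
                  , *R-distribʳ }
    ; *-comm = *R-comm } }

-- Partial derivatives

module K = CommutativeRing commutativeRing

dcoef : ℕ → Mono → ℤ
dcoef zero m = + 0
dcoef (suc zero) (mono e es) = e
dcoef (suc (suc i)) (mono e es) = + lookup0 es i

dmono : ℕ → Mono → Mono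
dmono zero m = m
dmono (suc zero) (mono e es) = mono (e - + 1) es
dmono (suc (suc i)) (mono e es) = mono e (decAt i es)

-- The transpose of `∂ j`: the multiplication by the exponent and the lowering of the exponent are
-- both moved from the list to the functional.
lin-∂ : ∀ f j p → lin f (∂ j p) ≡ lin (λ m → dcoef j m * f (dmono j m)) p
lin-∂ f zero p = sym (lin-0 p)
lin-∂ f (suc zero) [] = refl
lin-∂ f (suc zero) ((c , m) ∷ p) = cong₂ _+_ (ℤ.*-assoc c _ _) (lin-∂ f 1 p)
lin-∂ f (suc (suc i)) [] = refl
lin-∂ f (suc (suc i)) ((c , m) ∷ p) = cong₂ _+_ (ℤ.*-assoc c _ _) (lin-∂ f (suc (suc i)) p)

lookup-decAt : ∀ i xs j → lookup0 (decAt i xs) j ≡ (if i ℕ.≡ᵇ j then lookup0 xs j ℕ.∸ 1 else lookup0 xs j)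
lookup-decAt i [] j with i ℕ.≡ᵇ j
... | true = refl
... | false = refl
lookup-decAt zero (x ∷ xs) zero = refl
lookup-decAt zero (x ∷ xs) (suc j) = refl
lookup-decAt (suc i) (x ∷ xs) zero = refl
lookup-decAt (suc i) (x ∷ xs) (suc j) = lookup-decAt i xs j

dcoef-cong : ∀ j {m m'} → m ≋ m' → dcoef j m ≡ dcoef j m'
dcoef-cong zero h = refl
dcoef-cong (suc zero) (p , q) = p
dcoef-cong (suc (suc i)) (p , q) = cong +_ (q i)

dmono-cong : ∀ j {m m'} → m ≋ m' → dmono j m ≋ dmono j m'
dmono-cong zero h = h
dmono-cong (suc zero) (p , q) = cong (_- + 1) p , q
dmono-cong (suc (suc i)) {mono _ xs} {mono _ ys} (p , q) = p , λ j → begin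
  lookup0 (decAt i xs) j  ≡⟨ lookup-decAt i xs j ⟩
  (if i ℕ.≡ᵇ j then lookup0 xs j ℕ.∸ 1 else lookup0 xs j)
    ≡⟨ cong (λ a → if i ℕ.≡ᵇ j then a ℕ.∸ 1 else a) (q j) ⟩
  (if i ℕ.≡ᵇ j then lookup0 ys j ℕ.∸ 1 else lookup0 ys j)
    ≡⟨ lookup-decAt i ys j ⟨
  lookup0 (decAt i ys) j  ∎

dcoef-mul : ∀ j m n → dcoef j (mulMono m n) ≡ dcoef j m + dcoef j n
dcoef-mul zero m n = refl
dcoef-mul (suc zero) m n = refl
dcoef-mul (suc (suc i)) (mono _ xs) (mono _ ys) = trans (cong +_ (lookup-addExp xs ys i)) (ℤ.pos-+ (lookup0 xs i) _)

-- Truncated subtraction makes this fail when the exponent in `xs` is 0 and that in `ys` is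
-- positive: the left side then keeps the exponent that the right side lowers.
decAt-addExp : ∀ i xs ys → ¬ lookup0 xs i ≡ 0 → addExp (decAt i xs) ys ≐ decAt i (addExp xs ys)
decAt-addExp i xs ys h j = begin
  lookup0 (addExp (decAt i xs) ys) j              ≡⟨ lookup-addExp (decAt i xs) ys j ⟩
  lookup0 (decAt i xs) j ℕ.+ lookup0 ys j         ≡⟨ cong (ℕ._+ lookup0 ys j) (lookup-decAt i xs j) ⟩
  (if i ℕ.≡ᵇ j then lookup0 xs j ℕ.∸ 1 else lookup0 xs j) ℕ.+ lookup0 ys j
    ≡⟨ step ⟩
  (if i ℕ.≡ᵇ j then (lookup0 xs j ℕ.+ lookup0 ys j) ℕ.∸ 1 else (lookup0 xs j ℕ.+ lookup0 ys j))
    ≡⟨ cong (λ a → if i ℕ.≡ᵇ j then a ℕ.∸ 1 else a) (lookup-addExp xs ys j) ⟨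
  (if i ℕ.≡ᵇ j then lookup0 (addExp xs ys) j ℕ.∸ 1 else lookup0 (addExp xs ys) j)
    ≡⟨ lookup-decAt i (addExp xs ys) j ⟨
  lookup0 (decAt i (addExp xs ys)) j              ∎
  where
  step : (if i ℕ.≡ᵇ j then lookup0 xs j ℕ.∸ 1 else lookup0 xs j) ℕ.+ lookup0 ys j
    ≡ (if i ℕ.≡ᵇ j then (lookup0 xs j ℕ.+ lookup0 ys j) ℕ.∸ 1 else (lookup0 xs j ℕ.+ lookup0 ys j))
  step with i ℕ.≡ᵇ j | ℕ.≡ᵇ⇒≡ i j
  ... | false | _ = refl
  ... | true | i≡j with i≡j _
  ...   | refl with lookup0 xs i
  ...     | zero = contradiction refl h
  ...     | suc _ = refl

dmono-mul : ∀ j m n → ¬ dcoef j m ≡ + 0 → mulMono (dmono j m) n ≋ dmono j (mulMono m n)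
dmono-mul zero m n h = ≋-refl
dmono-mul (suc zero) (mono e _) (mono f _) h = step e f , λ _ → refl
  where
  step : ∀ e f → (e - + 1) + f ≡ e + f - + 1
  step = solve-∀
dmono-mul (suc (suc i)) (mono _ xs) (mono _ ys) h =
  refl , decAt-addExp i xs ys (λ k → h (cong +_ k))

-- The case excluded in `dmono-mul` is exponent 0, and there the coefficient `dcoef j m` kills both
-- sides.
dterm-mul : ∀ {f} → Respects f → ∀ j m n →
  dcoef j m * f (mulMono (dmono j m) n) ≡ dcoef j m * f (dmono j (mulMono m n))
dterm-mul {f} r j m n with dcoef j m ℤ.≟ + 0
... | yes h = trans (cong (_* f (mulMono (dmono j m) n)) h) (sym (cong (_* f (dmono j (mulMono m n))) h))
... | no h = cong (dcoef j m *_) (r _ _ (dmono-mul j m n h))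

dterm-respects : ∀ {f} → Respects f → ∀ j → Respects (λ m → dcoef j m * f (dmono j m))
dterm-respects r j _ _ h = cong₂ _*_ (dcoef-cong j h) (r _ _ (dmono-cong j h))

∂-cong : ∀ j p q → p ≈ q → ∂ j p ≈ ∂ j q
∂-cong j p q h = lin-≈ (∂ j p) (∂ j q) λ {f} r →
  trans (lin-∂ f j p) (trans (lin-cong (dterm-respects r j) p q h) (sym (lin-∂ f j q)))

∂-+ : ∀ j p q → ∂ j (p +R q) ≈ ∂ j p +R ∂ j q
∂-+ j p q = lin-≈ (∂ j (p +R q)) (∂ j p +R ∂ j q) λ {f} r →
  let g = λ m → dcoef j m * f (dmono j m) in begin
  lin f (∂ j (p +R q))                ≡⟨ lin-∂ f j (p +R q) ⟩
  lin g (p +R q)                      ≡⟨ lin-++ g p q ⟩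
  lin g p + lin g q                   ≡⟨ cong₂ _+_ (lin-∂ f j p) (lin-∂ f j q) ⟨
  lin f (∂ j p) + lin f (∂ j q)       ≡⟨ lin-++ f (∂ j p) (∂ j q) ⟨
  lin f (∂ j p +R ∂ j q)              ∎

-- Bilinearity leaves the case of two monomials. There the exponent of the product is the sum of the
-- two exponents, and in each of the two resulting summands the lowering can be moved onto the
-- factor that supplied the exponent.
∂-* : ∀ j p q → ∂ j (p *R q) ≈ ∂ j p *R q +R p *R ∂ j q
∂-* j p q = lin-≈ (∂ j (p *R q)) (∂ j p *R q +R p *R ∂ j q) λ {f} r →
  let a = λ m n → dcoef j m * f (mulMono (dmono j m) n)
      b = λ m n → dcoef j n * f (mulMono m (dmono j n)) in begin
  lin f (∂ j (p *R q))
    ≡⟨ lin-∂ f j (p *R q) ⟩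
  lin (λ m → dcoef j m * f (dmono j m)) (p *R q)
    ≡⟨ lin-* (λ m → dcoef j m * f (dmono j m)) p q ⟩
  lin (λ m → lin (λ n → dcoef j (mulMono m n) * f (dmono j (mulMono m n))) q) p
    ≡⟨ lin-ext (λ m → lin-ext (λ n → product-rule r m n) q) p ⟩
  lin (λ m → lin (λ n → a m n + b m n) q) p
    ≡⟨ lin-ext (λ m → lin-+ (a m) (b m) q) p ⟩
  lin (λ m → lin (a m) q + lin (b m) q) p
    ≡⟨ lin-+ (λ m → lin (a m) q) (λ m → lin (b m) q) p ⟩
  lin (λ m → lin (a m) q) p + lin (λ m → lin (b m) q) p
    ≡⟨ cong₂ _+_ (lin-ext (λ m → lin-scale (dcoef j m) (λ n → f (mulMono (dmono j m) n)) q) p)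
                 (lin-ext (λ m → sym (lin-∂ (λ n → f (mulMono m n)) j q)) p) ⟩
  lin (λ m → dcoef j m * lin (λ n → f (mulMono (dmono j m) n)) q) p
    + lin (λ m → lin (λ n → f (mulMono m n)) (∂ j q)) p
    ≡⟨ cong₂ _+_ (sym (lin-∂ (λ m → lin (λ n → f (mulMono m n)) q) j p)) (sym (lin-* f p (∂ j q))) ⟩
  lin (λ m → lin (λ n → f (mulMono m n)) q) (∂ j p) + lin f (p *R ∂ j q)
    ≡⟨ cong (λ x → x + lin f (p *R ∂ j q)) (sym (lin-* f (∂ j p) q)) ⟩
  lin f (∂ j p *R q) + lin f (p *R ∂ j q)
    ≡⟨ lin-++ f (∂ j p *R q) (p *R ∂ j q) ⟨
  lin f (∂ j p *R q +R p *R ∂ j q) ∎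
  where
  product-rule : ∀ {f} → Respects f → ∀ m n →
    dcoef j (mulMono m n) * f (dmono j (mulMono m n))
      ≡ dcoef j m * f (mulMono (dmono j m) n) + dcoef j n * f (mulMono m (dmono j n))
  product-rule {f} r m n = begin
    dcoef j (mulMono m n) * f (dmono j (mulMono m n))
      ≡⟨ cong (_* f (dmono j (mulMono m n))) (dcoef-mul j m n) ⟩
    (dcoef j m + dcoef j n) * f (dmono j (mulMono m n))
      ≡⟨ ℤ.*-distribʳ-+ (f (dmono j (mulMono m n))) (dcoef j m) (dcoef j n) ⟩
    dcoef j m * f (dmono j (mulMono m n)) + dcoef j n * f (dmono j (mulMono m n))
      ≡⟨ cong₂ _+_ (sym (dterm-mul r j m n)) (begin
        dcoef j n * f (dmono j (mulMono m n))
          ≡⟨ cong (dcoef j n *_) (r _ _ (dmono-cong j (mulMono-comm m n))) ⟩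
        dcoef j n * f (dmono j (mulMono n m))
          ≡⟨ dterm-mul r j n m ⟨
        dcoef j n * f (mulMono (dmono j n) m)
          ≡⟨ cong (dcoef j n *_) (r _ _ (mulMono-comm (dmono j n) m)) ⟩
        dcoef j n * f (mulMono m (dmono j n)) ∎) ⟩
    dcoef j m * f (mulMono (dmono j m) n) + dcoef j n * f (mulMono m (dmono j n)) ∎

-- The derivation D

-- An abstract ring is used because ≈ on R unfolds, which defeats the inference of implicit arguments.
module RingLemmas {c ℓ} (K : CommutativeRing c ℓ) where
  open CommutativeRing K hiding (refl; sym; trans)
    renaming (Carrier to C; _≈_ to _~_; _+_ to _⊕_; _*_ to _⊗_)
  open NatSolver commutativeSemiring using (solve; _:=_) renaming (_:*_ to _⊠_; _:+_ to _⊞_)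
  open SetoidReasoning setoid renaming (begin_ to begin~_; _∎ to _∎~)

  ~-refl : ∀ {x} → x ~ x
  ~-refl = CommutativeRing.refl K

  leibniz-sum : ∀ p q x a b d e {l m} →
    l ~ a ⊗ q ⊕ p ⊗ b → m ~ d ⊗ q ⊕ p ⊗ e →
    l ⊕ x ⊗ m ~ (a ⊕ x ⊗ d) ⊗ q ⊕ p ⊗ (b ⊕ x ⊗ e)
  leibniz-sum p q x a b d e {l} {m} hl hm = begin~
    l ⊕ x ⊗ m
      ≈⟨ +-cong hl (*-congˡ hm) ⟩
    (a ⊗ q ⊕ p ⊗ b) ⊕ x ⊗ (d ⊗ q ⊕ p ⊗ e)
      ≈⟨ solve 7 (λ p q x a b d e → (a ⊠ q ⊞ p ⊠ b) ⊞ x ⊠ (d ⊠ q ⊞ p ⊠ e)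
                    := (a ⊞ x ⊠ d) ⊠ q ⊞ p ⊠ (b ⊞ x ⊠ e)) ~-refl p q x a b d e ⟩
    (a ⊕ x ⊗ d) ⊗ q ⊕ p ⊗ (b ⊕ x ⊗ e) ∎~

  sum-+ : ∀ a b x d e {l m} → l ~ a ⊕ b → m ~ d ⊕ e →
    l ⊕ x ⊗ m ~ (a ⊕ x ⊗ d) ⊕ (b ⊕ x ⊗ e)
  sum-+ a b x d e {l} {m} hl hm = begin~
    l ⊕ x ⊗ m                      ≈⟨ +-cong hl (*-congˡ hm) ⟩
    (a ⊕ b) ⊕ x ⊗ (d ⊕ e)
      ≈⟨ solve 5 (λ a b x d e → (a ⊞ b) ⊞ x ⊠ (d ⊞ e) := (a ⊞ x ⊠ d) ⊞ (b ⊞ x ⊠ e)) ~-refl a b x d e ⟩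
    (a ⊕ x ⊗ d) ⊕ (b ⊕ x ⊗ e)      ∎~

  +-zero-summand : ∀ l x {m} → m ~ 0# → l ⊕ x ⊗ m ~ l
  +-zero-summand l x {m} hm = begin~
    l ⊕ x ⊗ m    ≈⟨ +-congˡ (CommutativeRing.trans K (*-congˡ hm) (zeroʳ x)) ⟩
    l ⊕ 0#       ≈⟨ +-identityʳ l ⟩
    l            ∎~

  only-summand : ∀ {l} x {m} → l ~ 0# → m ~ 1# → l ⊕ x ⊗ m ~ x
  only-summand {l} x {m} hl hm = begin~
    l ⊕ x ⊗ m    ≈⟨ +-cong hl (*-congˡ hm) ⟩
    0# ⊕ x ⊗ 1#  ≈⟨ +-identityˡ (x ⊗ 1#) ⟩
    x ⊗ 1#       ≈⟨ *-identityʳ x ⟩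
    x            ∎~

  interchange : ∀ a b u v {s r} → s ~ a ⊗ b → r ~ u ⊗ v → s ⊗ r ~ (a ⊗ u) ⊗ (b ⊗ v)
  interchange a b u v {s} {r} hs hr = begin~
    s ⊗ r                  ≈⟨ *-cong hs hr ⟩
    (a ⊗ b) ⊗ (u ⊗ v)
      ≈⟨ solve 4 (λ a b u v → (a ⊠ b) ⊠ (u ⊠ v) := (a ⊠ u) ⊠ (b ⊠ v)) ~-refl a b u v ⟩
    (a ⊗ u) ⊗ (b ⊗ v)      ∎~

  inverse-cancel : ∀ y y⁻¹ a b {p} → y ⊗ y⁻¹ ~ 1# → p ~ a ⊗ b → p ~ (y ⊗ a) ⊗ (y⁻¹ ⊗ b)
  inverse-cancel y y⁻¹ a b {p} h hp = begin~
    p                        ≈⟨ *-identityˡ p ⟨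
    1# ⊗ p                   ≈⟨ interchange y y⁻¹ a b (CommutativeRing.sym K h) hp ⟩
    (y ⊗ a) ⊗ (y⁻¹ ⊗ b)      ∎~

  reassoc : ∀ p a b {q} → q ~ a ⊗ b → p ⊗ q ~ (p ⊗ a) ⊗ b
  reassoc p a b h = CommutativeRing.trans K (*-congˡ h) (CommutativeRing.sym K (*-assoc p a b))

  -- The algebra that turns the recursion for `S` into that for `A`, with `x` and `v` for `X 1` and
  -- its inverse, `y` for `X 2`, and `u` and `w` for the prefactors of `A` in rows `n` and `n + 1`.
  -- Since `Du` is `c u v y`, the summand `c y s` supplies the term `Du s` of the Leibniz rule, and
  -- the summand with the factor `x` supplies the rest.
  rescale : ∀ x v u c y s s' d {w t Du Dus} → x ⊗ v ~ 1# → w ~ u ⊗ v ⊗ v → t ~ d →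
    Du ~ c ⊗ (u ⊗ v ⊗ y) → Dus ~ Du ⊗ s ⊕ u ⊗ d →
    w ⊗ (c ⊗ y ⊗ s ⊕ x ⊗ (s' ⊕ t)) ~ v ⊗ (u ⊗ s' ⊕ Dus)
  rescale x v u c y s s' d {w} {t} {Du} {Dus} xv hw ht hDu hDus = begin~
    w ⊗ (c ⊗ y ⊗ s ⊕ x ⊗ (s' ⊕ t))
      ≈⟨ *-cong hw (+-congˡ (*-congˡ (+-congˡ ht))) ⟩
    u ⊗ v ⊗ v ⊗ (c ⊗ y ⊗ s ⊕ x ⊗ (s' ⊕ d))
      ≈⟨ solve 8 (λ x v u c y s s' d → u ⊠ v ⊠ v ⊠ (c ⊠ y ⊠ s ⊞ x ⊠ (s' ⊞ d))
            := v ⊠ (c ⊠ (u ⊠ v ⊠ y) ⊠ s) ⊞ (x ⊠ v) ⊠ (v ⊠ (u ⊠ (s' ⊞ d)))) ~-refl x v u c y s s' d ⟩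
    v ⊗ (c ⊗ (u ⊗ v ⊗ y) ⊗ s) ⊕ (x ⊗ v) ⊗ (v ⊗ (u ⊗ (s' ⊕ d)))
      ≈⟨ +-congˡ (CommutativeRing.trans K (*-congʳ xv) (*-identityˡ _)) ⟩
    v ⊗ (c ⊗ (u ⊗ v ⊗ y) ⊗ s) ⊕ v ⊗ (u ⊗ (s' ⊕ d))
      ≈⟨ solve 8 (λ x v u c y s s' d → v ⊠ (c ⊠ (u ⊠ v ⊠ y) ⊠ s) ⊞ v ⊠ (u ⊠ (s' ⊞ d))
            := v ⊠ (u ⊠ s' ⊞ (c ⊠ (u ⊠ v ⊠ y) ⊠ s ⊞ u ⊠ d))) ~-refl x v u c y s s' d ⟩
    v ⊗ (u ⊗ s' ⊕ (c ⊗ (u ⊗ v ⊗ y) ⊗ s ⊕ u ⊗ d))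
      ≈⟨ *-congˡ (+-congˡ (CommutativeRing.trans K hDus (+-congʳ (*-congʳ hDu)))) ⟨
    v ⊗ (u ⊗ s' ⊕ Dus) ∎~

module L = RingLemmas commutativeRing

D≤ : ℕ → R → R
D≤ N p = ΣR N (λ j → X (suc j) *R ∂ j p)

-- An upper bound for the indices of the variables occurring in the list p.
bound : R → ℕ
bound [] = 0
bound ((c , mono e es) ∷ p) = suc (length es) ℕ.⊔ bound p

-- The infinite sum of all `X (suc j) *R ∂ j p`, cut off where the list `p` has no further
-- variables. The cut-off depends on the list and not only on the element that it represents.
D : R → R
D p = D≤ (bound p) p

lookup-beyond : ∀ xs i → length xs ≤ i → lookup0 xs i ≡ 0
lookup-beyond [] i h = refl
lookup-beyond (x ∷ xs) (suc i) (s≤s h) = lookup-beyond xs i h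

lin-∂-beyond : ∀ f j p → bound p < j → lin f (∂ j p) ≡ + 0
lin-∂-beyond f j p h = trans (lin-∂ f j p) (go j p h)
  where
  dcoef-beyond : ∀ j e es → suc (length es) < j → dcoef j (mono e es) ≡ + 0
  dcoef-beyond (suc (suc i)) e es (s≤s (s≤s h)) = cong +_ (lookup-beyond es i h)
  go : ∀ j p → bound p < j → lin (λ m → dcoef j m * f (dmono j m)) p ≡ + 0
  go j [] h = refl
  go j ((c , m@(mono e es)) ∷ p) h = begin
    c * (dcoef j m * f (dmono j m)) + lin (λ m → dcoef j m * f (dmono j m)) p
      ≡⟨ cong₂ (λ x y → c * (x * f (dmono j m)) + y)
           (dcoef-beyond j e es (ℕ.≤-<-trans (ℕ.m≤m⊔n _ (bound p)) h))
           (go j p (ℕ.≤-<-trans (ℕ.m≤n⊔m (suc (length es)) _) h)) ⟩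
    c * (+ 0 * f (dmono j m)) + + 0
      ≡⟨ trans (ℤ.+-identityʳ _) (ℤ.*-zeroʳ c) ⟩
    + 0 ∎

D≤-cong : ∀ N p q → p ≈ q → D≤ N p ≈ D≤ N q
D≤-cong zero p q h = λ _ → refl
D≤-cong (suc N) p q h = +R-cong (D≤ N p) (D≤ N q) (X (suc (suc N)) *R ∂ (suc N) p) (X (suc (suc N)) *R ∂ (suc N) q)
  (D≤-cong N p q h)
  (*R-cong (X (suc (suc N))) (X (suc (suc N))) (∂ (suc N) p) (∂ (suc N) q) (λ _ → refl) (∂-cong (suc N) p q h))

D≤-+ : ∀ N p q → D≤ N (p +R q) ≈ D≤ N p +R D≤ N q
D≤-+ zero p q = λ _ → refl
D≤-+ (suc N) p q =
  L.sum-+ (D≤ N p) (D≤ N q) (X (suc (suc N))) (∂ (suc N) p) (∂ (suc N) q)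
    {D≤ N (p +R q)} {∂ (suc N) (p +R q)} (D≤-+ N p q) (∂-+ (suc N) p q)

D≤-* : ∀ N p q → D≤ N (p *R q) ≈ D≤ N p *R q +R p *R D≤ N q
D≤-* zero p q m = sym (trans (*R-comm p 0R m) refl)
D≤-* (suc N) p q =
  L.leibniz-sum p q (X (suc (suc N))) (D≤ N p) (D≤ N q) (∂ (suc N) p) (∂ (suc N) q)
    {D≤ N (p *R q)} {∂ (suc N) (p *R q)} (D≤-* N p q) (∂-* (suc N) p q)

-- Partial derivatives beyond the bound vanish. This allows one common cut-off for several lists,
-- which is how the laws of `D` follow from those of `D≤ N`.
D≤-stable : ∀ N p → bound p ≤ N → D≤ N p ≈ D p
D≤-stable N p h = subst (λ M → D≤ M p ≈ D p) (ℕ.m∸n+n≡m h) (go (N ℕ.∸ bound p))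
  where
  go : ∀ k → D≤ (k ℕ.+ bound p) p ≈ D p
  go zero = λ _ → refl
  go (suc k) = K.trans {D≤ (suc k ℕ.+ bound p) p} {D≤ (k ℕ.+ bound p) p} {D p}
    (L.+-zero-summand (D≤ (k ℕ.+ bound p) p) (X (suc (suc (k ℕ.+ bound p)))) {∂ (suc (k ℕ.+ bound p)) p}
      (lin-≈ (∂ (suc (k ℕ.+ bound p)) p) 0R λ {f} _ →
        lin-∂-beyond f (suc (k ℕ.+ bound p)) p (s≤s (ℕ.m≤n+m (bound p) k))))
    (go k)

D-cong : ∀ p q → p ≈ q → D p ≈ D q
D-cong p q h m = begin
  coeff (D p) m      ≡⟨ D≤-stable N p (ℕ.m≤m⊔n (bound p) (bound q)) m ⟨
  coeff (D≤ N p) m   ≡⟨ D≤-cong N p q h m ⟩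
  coeff (D≤ N q) m   ≡⟨ D≤-stable N q (ℕ.m≤n⊔m (bound p) (bound q)) m ⟩
  coeff (D q) m      ∎
  where N = bound p ℕ.⊔ bound q

D-+ : ∀ p q → D (p +R q) ≈ D p +R D q
D-+ p q m = begin
  coeff (D (p +R q)) m        ≡⟨ D≤-stable N (p +R q) (ℕ.m≤n⊔m (bound p ℕ.⊔ bound q) _) m ⟨
  coeff (D≤ N (p +R q)) m     ≡⟨ D≤-+ N p q m ⟩
  coeff (D≤ N p +R D≤ N q) m
    ≡⟨ +R-cong (D≤ N p) (D p) (D≤ N q) (D q)
         (D≤-stable N p (ℕ.≤-trans (ℕ.m≤m⊔n (bound p) (bound q)) (ℕ.m≤m⊔n _ _)))
         (D≤-stable N q (ℕ.≤-trans (ℕ.m≤n⊔m (bound p) (bound q)) (ℕ.m≤m⊔n _ _))) m ⟩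
  coeff (D p +R D q) m        ∎
  where N = bound p ℕ.⊔ bound q ℕ.⊔ bound (p +R q)

D-* : ∀ p q → D (p *R q) ≈ D p *R q +R p *R D q
D-* p q m = begin
  coeff (D (p *R q)) m        ≡⟨ D≤-stable N (p *R q) (ℕ.m≤n⊔m (bound p ℕ.⊔ bound q) _) m ⟨
  coeff (D≤ N (p *R q)) m     ≡⟨ D≤-* N p q m ⟩
  coeff (D≤ N p *R q +R p *R D≤ N q) m
    ≡⟨ +R-cong (D≤ N p *R q) (D p *R q) (p *R D≤ N q) (p *R D q)
         (*R-cong (D≤ N p) (D p) q q
           (D≤-stable N p (ℕ.≤-trans (ℕ.m≤m⊔n (bound p) (bound q)) (ℕ.m≤m⊔n _ _))) (λ _ → refl))
         (*R-cong p p (D≤ N q) (D q) (λ _ → refl)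
           (D≤-stable N q (ℕ.≤-trans (ℕ.m≤n⊔m (bound p) (bound q)) (ℕ.m≤m⊔n _ _)))) m ⟩
  coeff (D p *R q +R p *R D q) m ∎
  where N = bound p ℕ.⊔ bound q ℕ.⊔ bound (p *R q)

-- Values of `D` on constants, variables and powers of `X 1`

zero-term : ∀ {c} m → c ≡ + 0 → (c , m) ∷ [] ≈ 0R
zero-term m refl m₀ with sameMono m m₀
... | true = refl
... | false = refl

term-cong : ∀ {c d} m n → c ≡ d → m ≋ n → (c , m) ∷ [] ≈ (d , n) ∷ []
term-cong {c} m n refl h m₀ =
  cong (λ b → (if b then c else + 0) + + 0) (sameMono-congˡ {m} {n} {m₀} h)

unitExp : ℕ → List ℕ
unitExp i = replicate i 0 ++ (1 ∷ [])

lookup-unitExp-self : ∀ i → lookup0 (unitExp i) i ≡ 1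
lookup-unitExp-self zero = refl
lookup-unitExp-self (suc i) = lookup-unitExp-self i

lookup-unitExp-other : ∀ i j → ¬ i ≡ j → lookup0 (unitExp i) j ≡ 0
lookup-unitExp-other zero zero h = contradiction refl h
lookup-unitExp-other zero (suc j) h = refl
lookup-unitExp-other (suc i) zero h = refl
lookup-unitExp-other (suc i) (suc j) h = lookup-unitExp-other i j (λ k → h (cong suc k))

decAt-unitExp : ∀ i → decAt i (unitExp i) ≐ []
decAt-unitExp zero zero = refl
decAt-unitExp zero (suc j) = refl
decAt-unitExp (suc i) zero = refl
decAt-unitExp (suc i) (suc j) = decAt-unitExp i j

length-unitExp : ∀ i → length (unitExp i) ≡ suc i
length-unitExp zero = refl
length-unitExp (suc i) = cong suc (length-unitExp i)

∂-X-self : ∀ i → ∂ (suc i) (X (suc i)) ≈ 1R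
∂-X-self zero = λ _ → refl
∂-X-self (suc i) = term-cong (mono (+ 0) (decAt i (unitExp i))) 1M
  (trans (ℤ.*-identityˡ _) (cong +_ (lookup-unitExp-self i))) (refl , decAt-unitExp i)

∂-X-other : ∀ i j → ¬ i ≡ j → ∂ (suc j) (X (suc i)) ≈ 0R
∂-X-other zero zero h = contradiction refl h
∂-X-other zero (suc j) h = zero-term (mono (+ 1) []) refl
∂-X-other (suc i) zero h = zero-term (mono (+ 0 - + 1) (unitExp i)) refl
∂-X-other (suc i) (suc j) h = zero-term (mono (+ 0) (decAt j (unitExp i)))
  (trans (ℤ.*-identityˡ _) (cong +_ (lookup-unitExp-other i j (λ k → h (cong suc k)))))

bound-X : ∀ i → bound (X (suc i)) ≡ suc i
bound-X zero = refl
bound-X (suc i) = trans (ℕ.⊔-identityʳ _) (cong suc (length-unitExp i))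

-- With the cut-off at `suc i` the last summand is `X (suc (suc i))` times 1, and all earlier ones
-- differentiate by another variable.
D-X : ∀ i → D (X (suc i)) ≈ X (suc (suc i))
D-X i = K.trans {D (X (suc i))} {D≤ (suc i) (X (suc i))} {X (suc (suc i))}
  (K.sym {D≤ (suc i) (X (suc i))} {D (X (suc i))}
    (D≤-stable (suc i) (X (suc i)) (ℕ.≤-reflexive (bound-X i))))
  (L.only-summand {D≤ i (X (suc i))} (X (suc (suc i))) {∂ (suc i) (X (suc i))}
    (below i ℕ.≤-refl) (∂-X-self i))
  where
  below : ∀ N → N ≤ i → D≤ N (X (suc i)) ≈ 0R
  below zero h = λ _ → refl
  below (suc N) h = K.trans {D≤ (suc N) (X (suc i))} {D≤ N (X (suc i))} {0R}
    (L.+-zero-summand (D≤ N (X (suc i))) (X (suc (suc N))) {∂ (suc N) (X (suc i))}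
      (∂-X-other i N (λ k → ℕ.<-irrefl (sym k) h)))
    (below N (ℕ.≤-trans (ℕ.n≤1+n N) h))

D-const : ∀ c → D (const c) ≈ 0R
D-const c = K.trans {D≤ 1 (const c)} {0R +R 0R} {0R}
  (L.+-zero-summand 0R (X 2) {∂ 1 (const c)} (zero-term (mono (+ 0 - + 1) []) (ℤ.*-zeroʳ c)))
  (λ _ → refl)

D-X₁^ : ∀ e → D (X₁^ e) ≈ const e *R (X₁^ (e - + 1) *R X 2)
D-X₁^ e = term-cong (mono (+ 0 + (e - + 1)) (1 ∷ [])) (mono (+ 0 + (e - + 1 + + 0)) (1 ∷ [])) (step₁ e) (step₂ e , λ i → refl)
  where
  step₁ : ∀ e → + 1 * (+ 1 * e) ≡ e * + 1
  step₁ = solve-∀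
  step₂ : ∀ e → + 0 + (e - + 1) ≡ + 0 + (e - + 1 + + 0)
  step₂ = solve-∀

-- Evaluation

^R-+ : ∀ p a b → p ^R (a ℕ.+ b) ≈ p ^R a *R p ^R b
^R-+ p zero b = K.sym {1R *R p ^R b} {p ^R b} (*R-identityˡ (p ^R b))
^R-+ p (suc a) b = L.reassoc p (p ^R a) (p ^R b) (^R-+ p a b)

module Evaluation (Y : ℕ → R) (Y₁⁻¹ : R) (unit : Y 1 *R Y₁⁻¹ ≈ 1R) where

  φ : R → R
  φ = evalWith Y Y₁⁻¹

  φMono : Mono → R
  φMono = evalMono Y Y₁⁻¹

  -- `a ⊖ b` crosses between the two clauses of `pow₁`. Each common successor inserts one factor
  -- `Y 1 *R Y₁⁻¹`, so this is where `unit` enters.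
  pow₁-⊖ : ∀ a b → pow₁ Y Y₁⁻¹ (a ⊖ b) ≈ Y 1 ^R a *R Y₁⁻¹ ^R b
  pow₁-⊖ zero zero = λ _ → refl
  pow₁-⊖ (suc a) zero = K.sym {Y 1 ^R suc a *R 1R} {Y 1 ^R suc a} (K.*-identityʳ (Y 1 ^R suc a))
  pow₁-⊖ zero (suc b) = K.sym {1R *R Y₁⁻¹ ^R suc b} {Y₁⁻¹ ^R suc b} (*R-identityˡ (Y₁⁻¹ ^R suc b))
  pow₁-⊖ (suc a) (suc b) = subst (λ e → pow₁ Y Y₁⁻¹ e ≈ Y 1 ^R suc a *R Y₁⁻¹ ^R suc b)
    (sym (ℤ.[1+m]⊖[1+n]≡m⊖n a b))
    (L.inverse-cancel (Y 1) Y₁⁻¹ (Y 1 ^R a) (Y₁⁻¹ ^R b) {pow₁ Y Y₁⁻¹ (a ⊖ b)} unit (pow₁-⊖ a b))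

  pow₁-+ : ∀ e f → pow₁ Y Y₁⁻¹ (e + f) ≈ pow₁ Y Y₁⁻¹ e *R pow₁ Y Y₁⁻¹ f
  pow₁-+ (+ a) (+ b) = ^R-+ (Y 1) a b
  pow₁-+ (+ a) -[1+ b ] = pow₁-⊖ a (suc b)
  pow₁-+ -[1+ a ] (+ b) = K.trans {pow₁ Y Y₁⁻¹ (b ⊖ suc a)} {Y 1 ^R b *R Y₁⁻¹ ^R suc a} {Y₁⁻¹ ^R suc a *R Y 1 ^R b}
    (pow₁-⊖ b (suc a)) (*R-comm (Y 1 ^R b) (Y₁⁻¹ ^R suc a))
  pow₁-+ -[1+ a ] -[1+ b ] = subst (λ n → Y₁⁻¹ ^R suc n ≈ Y₁⁻¹ ^R suc a *R Y₁⁻¹ ^R suc b)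
    (ℕ.+-suc a b) (^R-+ Y₁⁻¹ (suc a) (suc b))

  powRest-+ : ∀ i xs ys →
    powRest Y Y₁⁻¹ i (addExp xs ys) ≈ powRest Y Y₁⁻¹ i xs *R powRest Y Y₁⁻¹ i ys
  powRest-+ i [] ys = K.sym {1R *R powRest Y Y₁⁻¹ i ys} {powRest Y Y₁⁻¹ i ys} (*R-identityˡ (powRest Y Y₁⁻¹ i ys))
  powRest-+ i (x ∷ xs) [] = K.sym {powRest Y Y₁⁻¹ i (x ∷ xs) *R 1R} {powRest Y Y₁⁻¹ i (x ∷ xs)}
    (K.*-identityʳ (powRest Y Y₁⁻¹ i (x ∷ xs)))
  powRest-+ i (x ∷ xs) (y ∷ ys) = L.interchange
    (Y i ^R x) (Y i ^R y) (powRest Y Y₁⁻¹ (suc i) xs) (powRest Y Y₁⁻¹ (suc i) ys)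
    {Y i ^R (x ℕ.+ y)} {powRest Y Y₁⁻¹ (suc i) (addExp xs ys)}
    (^R-+ (Y i) x y) (powRest-+ (suc i) xs ys)

  powRest-zero : ∀ i xs → xs ≐ [] → powRest Y Y₁⁻¹ i xs ≈ 1R
  powRest-zero i [] h = λ _ → refl
  powRest-zero i (x ∷ xs) h rewrite h 0 = K.trans {1R *R powRest Y Y₁⁻¹ (suc i) xs} {powRest Y Y₁⁻¹ (suc i) xs} {1R}
    (*R-identityˡ (powRest Y Y₁⁻¹ (suc i) xs)) (powRest-zero (suc i) xs (λ j → h (suc j)))

  powRest-cong : ∀ i xs ys → xs ≐ ys → powRest Y Y₁⁻¹ i xs ≈ powRest Y Y₁⁻¹ i ys
  powRest-cong i [] ys h = K.sym {powRest Y Y₁⁻¹ i ys} {1R} (powRest-zero i ys (λ j → sym (h j)))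
  powRest-cong i (x ∷ xs) [] h = powRest-zero i (x ∷ xs) h
  powRest-cong i (x ∷ xs) (y ∷ ys) h rewrite h 0 = *R-cong
    (Y i ^R y) (Y i ^R y) (powRest Y Y₁⁻¹ (suc i) xs) (powRest Y Y₁⁻¹ (suc i) ys)
    (λ _ → refl) (powRest-cong (suc i) xs ys (λ j → h (suc j)))

  φMono-cong : ∀ m m' → m ≋ m' → φMono m ≈ φMono m'
  φMono-cong (mono e xs) (mono f ys) (p , q) = *R-cong
    (pow₁ Y Y₁⁻¹ e) (pow₁ Y Y₁⁻¹ f) (powRest Y Y₁⁻¹ 2 xs) (powRest Y Y₁⁻¹ 2 ys)
    (λ m → cong (λ g → coeff (pow₁ Y Y₁⁻¹ g) m) p) (powRest-cong 2 xs ys q)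

  φMono-* : ∀ m n → φMono (mulMono m n) ≈ φMono m *R φMono n
  φMono-* (mono e xs) (mono f ys) = L.interchange
    (pow₁ Y Y₁⁻¹ e) (pow₁ Y Y₁⁻¹ f) (powRest Y Y₁⁻¹ 2 xs) (powRest Y Y₁⁻¹ 2 ys)
    {pow₁ Y Y₁⁻¹ (e + f)} {powRest Y Y₁⁻¹ 2 (addExp xs ys)}
    (pow₁-+ e f) (powRest-+ 2 xs ys)

  lin-φ : ∀ {f} → Respects f → ∀ p → lin f (φ p) ≡ lin (λ m → lin f (φMono m)) p
  lin-φ r [] = refl
  lin-φ {f} r ((c , m) ∷ p) = trans (lin-++ f (const c *R φMono m) (φ p))
    (cong₂ _+_ (lin-const* r c (φMono m)) (lin-φ r p))

  φ-cong : ∀ p q → p ≈ q → φ p ≈ φ q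
  φ-cong p q h = lin-≈ (φ p) (φ q) λ {f} r → trans (lin-φ r p) (trans
    (lin-cong (λ m m' k → lin-cong r (φMono m) (φMono m') (φMono-cong m m' k)) p q h)
    (sym (lin-φ r q)))

  φ-+ : ∀ p q → φ (p +R q) ≈ φ p +R φ q
  φ-+ p q = lin-≈ (φ (p +R q)) (φ p +R φ q) λ {f} r →
    let g = λ m → lin f (φMono m) in begin
    lin f (φ (p +R q))           ≡⟨ lin-φ r (p +R q) ⟩
    lin g (p +R q)               ≡⟨ lin-++ g p q ⟩
    lin g p + lin g q            ≡⟨ cong₂ _+_ (lin-φ r p) (lin-φ r q) ⟨
    lin f (φ p) + lin f (φ q)    ≡⟨ lin-++ f (φ p) (φ q) ⟨
    lin f (φ p +R φ q)           ∎

  -- After the reduction to `φMono-*`, the sum over the terms of `q` stands outside the sum over the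
  -- terms of `φMono m`. Exchanging the two lets the inner sums reassemble to `φ q`, and then the
  -- outer ones to `φ p`.
  φ-* : ∀ p q → φ (p *R q) ≈ φ p *R φ q
  φ-* p q = lin-≈ (φ (p *R q)) (φ p *R φ q) λ {f} r → begin
    lin f (φ (p *R q))
      ≡⟨ lin-φ r (p *R q) ⟩
    lin (λ m → lin f (φMono m)) (p *R q)
      ≡⟨ lin-* (λ m → lin f (φMono m)) p q ⟩
    lin (λ m → lin (λ n → lin f (φMono (mulMono m n))) q) p
      ≡⟨ lin-ext (λ m → lin-ext (λ n → lin-cong r (φMono (mulMono m n)) (φMono m *R φMono n) (φMono-* m n)) q) p ⟩
    lin (λ m → lin (λ n → lin f (φMono m *R φMono n)) q) p
      ≡⟨ lin-ext (λ m → lin-ext (λ n → lin-* f (φMono m) (φMono n)) q) p ⟩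
    lin (λ m → lin (λ n → lin (λ a → lin (λ b → f (mulMono a b)) (φMono n)) (φMono m)) q) p
      ≡⟨ lin-ext (λ m → lin-swap (λ a n → lin (λ b → f (mulMono a b)) (φMono n)) (φMono m) q) p ⟨
    lin (λ m → lin (λ a → lin (λ n → lin (λ b → f (mulMono a b)) (φMono n)) q) (φMono m)) p
      ≡⟨ lin-ext (λ m → lin-ext (λ a → lin-φ (mulMono-respectsʳ r a) q) (φMono m)) p ⟨
    lin (λ m → lin (λ a → lin (λ b → f (mulMono a b)) (φ q)) (φMono m)) p
      ≡⟨ lin-φ (lin-mul-respects r (φ q)) p ⟨
    lin (λ a → lin (λ b → f (mulMono a b)) (φ q)) (φ p)
      ≡⟨ lin-* f (φ p) (φ q) ⟨
    lin f (φ p *R φ q) ∎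

  φ-term : ∀ c m {y} → φMono m ≈ y → φ ((c , m) ∷ []) ≈ const c *R y
  φ-term c m {y} h = K.trans {φ ((c , m) ∷ [])} {const c *R φMono m} {const c *R y}
    (K.+-identityʳ (const c *R φMono m)) (*R-cong (const c) (const c) (φMono m) y (λ _ → refl) h)

  φ-const : ∀ c → φ (const c) ≈ const c
  φ-const c = K.trans {φ (const c)} {const c *R 1R} {const c}
    (φ-term c 1M {1R} (λ _ → refl)) (K.*-identityʳ (const c))

  φ-X₁^ : ∀ e {y} → pow₁ Y Y₁⁻¹ e ≈ y → φ (X₁^ e) ≈ y
  φ-X₁^ e {y} h = K.trans {φ (X₁^ e)} {1R *R y} {y}
    (φ-term (+ 1) (mono e []) {y} (K.trans {φMono (mono e [])} {pow₁ Y Y₁⁻¹ e} {y} (K.*-identityʳ (pow₁ Y Y₁⁻¹ e)) h))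
    (*R-identityˡ y)

  φ-X : ∀ i → φ (X (suc i)) ≈ Y (suc i)
  φ-X zero = φ-X₁^ (+ 1) {Y 1} (K.*-identityʳ (Y 1))
  φ-X (suc i) = K.trans {φ (X (suc (suc i)))} {1R *R Y (suc (suc i))} {Y (suc (suc i))}
    (φ-term (+ 1) (mono (+ 0) (unitExp i)) {Y (suc (suc i))}
      (K.trans {φMono (mono (+ 0) (unitExp i))} {powRest Y Y₁⁻¹ 2 (unitExp i)} {Y (suc (suc i))}
        (*R-identityˡ (powRest Y Y₁⁻¹ 2 (unitExp i))) (powRest-unitExp 2 i)))
    (*R-identityˡ (Y (suc (suc i))))
    where
    powRest-unitExp : ∀ j i → powRest Y Y₁⁻¹ j (unitExp i) ≈ Y (j ℕ.+ i)
    powRest-unitExp j zero = subst (λ k → powRest Y Y₁⁻¹ j (unitExp 0) ≈ Y k) (sym (ℕ.+-identityʳ j))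
      (K.trans {(Y j *R 1R) *R 1R} {Y j *R 1R} {Y j} (K.*-identityʳ (Y j *R 1R)) (K.*-identityʳ (Y j)))
    powRest-unitExp j (suc i) = subst (λ k → powRest Y Y₁⁻¹ j (unitExp (suc i)) ≈ Y k) (sym (ℕ.+-suc j i))
      (K.trans {1R *R powRest Y Y₁⁻¹ (suc j) (unitExp i)} {powRest Y Y₁⁻¹ (suc j) (unitExp i)} {Y (suc j ℕ.+ i)}
        (*R-identityˡ (powRest Y Y₁⁻¹ (suc j) (unitExp i))) (powRest-unitExp (suc j) i))

  φ-X₁⁻¹ : φ (X₁^ (- + 1)) ≈ Y₁⁻¹
  φ-X₁⁻¹ = φ-X₁^ (- + 1) {Y₁⁻¹} (K.*-identityʳ Y₁⁻¹)

-- Generation of R by the constants, the X i and X₁⁻¹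

X₁⁻¹ : R
X₁⁻¹ = X₁^ (- + 1)

X₁-unit : X 1 *R X₁⁻¹ ≈ 1R
X₁-unit _ = refl

monomial : Mono → R
monomial m = (+ 1 , m) ∷ []

monomial-* : ∀ m n {p q} → p ≈ monomial m → q ≈ monomial n → p *R q ≈ monomial (mulMono m n)
monomial-* m n {p} {q} = *R-cong p (monomial m) q (monomial n)

monomial-cong : ∀ m n → m ≋ n → monomial m ≈ monomial n
monomial-cong m n = term-cong m n refl

X-power : ∀ i a → X (suc (suc i)) ^R a ≈ monomial (mono (+ 0) (replicate i 0 ++ (a ∷ [])))
X-power i zero = monomial-cong 1M (mono (+ 0) (replicate i 0 ++ (0 ∷ []))) (refl , zeros i)
  where
  zeros : ∀ i j → 0 ≡ lookup0 (replicate i 0 ++ (0 ∷ [])) j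
  zeros zero zero = refl
  zeros zero (suc j) = refl
  zeros (suc i) zero = refl
  zeros (suc i) (suc j) = zeros i j
X-power i (suc a) = subst (λ es → X (suc (suc i)) ^R suc a ≈ monomial (mono (+ 0) es)) (shifted i)
  (monomial-* (mono (+ 0) (unitExp i)) (mono (+ 0) (replicate i 0 ++ (a ∷ [])))
    {X (suc (suc i))} {X (suc (suc i)) ^R a} (λ _ → refl) (X-power i a))
  where
  shifted : ∀ i → addExp (unitExp i) (replicate i 0 ++ (a ∷ [])) ≡ replicate i 0 ++ (suc a ∷ [])
  shifted zero = refl
  shifted (suc i) = cong (0 ∷_) (shifted i)

powRest-X : ∀ i es → powRest X X₁⁻¹ (suc (suc i)) es ≈ monomial (mono (+ 0) (replicate i 0 ++ es))
powRest-X i [] = monomial-cong 1M (mono (+ 0) (replicate i 0 ++ [])) (refl , zeros i)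
  where
  zeros : ∀ i j → 0 ≡ lookup0 (replicate i 0 ++ []) j
  zeros zero j = refl
  zeros (suc i) zero = refl
  zeros (suc i) (suc j) = zeros i j
powRest-X i (a ∷ as) = subst (λ es → powRest X X₁⁻¹ (suc (suc i)) (a ∷ as) ≈ monomial (mono (+ 0) es)) (shifted i)
  (monomial-* (mono (+ 0) (replicate i 0 ++ (a ∷ []))) (mono (+ 0) (replicate (suc i) 0 ++ as))
    {X (suc (suc i)) ^R a} {powRest X X₁⁻¹ (suc (suc (suc i))) as} (X-power i a) (powRest-X (suc i) as))
  where
  shifted : ∀ i → addExp (replicate i 0 ++ (a ∷ [])) (replicate (suc i) 0 ++ as) ≡ replicate i 0 ++ (a ∷ as)
  shifted zero = cong (_∷ as) (ℕ.+-identityʳ a)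
  shifted (suc i) = cong (0 ∷_) (shifted i)

pow₁-X : ∀ e → pow₁ X X₁⁻¹ e ≈ X₁^ e
pow₁-X (+ zero) = λ _ → refl
pow₁-X (+ suc n) = monomial-* (mono (+ 1) []) (mono (+ n) []) {X 1} {X 1 ^R n} (λ _ → refl) (pow₁-X (+ n))
pow₁-X -[1+ zero ] = λ _ → refl
pow₁-X -[1+ suc n ] = monomial-* (mono (- + 1) []) (mono -[1+ n ] []) {X₁⁻¹} {X₁⁻¹ ^R suc n} (λ _ → refl) (pow₁-X -[1+ n ])

evalMono-X : ∀ m → evalMono X X₁⁻¹ m ≈ monomial m
evalMono-X (mono e es) = K.trans {pow₁ X X₁⁻¹ e *R powRest X X₁⁻¹ 2 es} {monomial (mono (e + + 0) es)} {monomial (mono e es)}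
  (monomial-* (mono e []) (mono (+ 0) es) {pow₁ X X₁⁻¹ e} {powRest X X₁⁻¹ 2 es} (pow₁-X e) (powRest-X 0 es))
  (monomial-cong (mono (e + + 0) es) (mono e es) (ℤ.+-identityʳ e , λ _ → refl))

evalWith-X : ∀ p → evalWith X X₁⁻¹ p ≈ p
evalWith-X p = lin-≈ (evalWith X X₁⁻¹ p) p λ {f} r → trans (lin-φ r p) (lin-ext (λ m → begin
  lin f (evalMono X X₁⁻¹ m)   ≡⟨ lin-cong r (evalMono X X₁⁻¹ m) (monomial m) (evalMono-X m) ⟩
  + 1 * f m + + 0             ≡⟨ trans (ℤ.+-identityʳ _) (ℤ.*-identityˡ _) ⟩
  f m                         ∎) p)
  where open Evaluation X X₁⁻¹ X₁-unit

-- Substituting the variables for themselves writes `p` with constants, variables, `X₁⁻¹`, sums and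
-- products only, and `evalWith-X` says that the value is again `p`.
R-induction : (P : R → Set) → (∀ p q → p ≈ q → P p → P q) →
  (∀ c → P (const c)) → (∀ i → P (X (suc i))) → P X₁⁻¹ →
  (∀ p q → P p → P q → P (p +R q)) → (∀ p q → P p → P q → P (p *R q)) →
  ∀ p → P p
R-induction P P-resp P-const P-X P-X₁⁻¹ P-+ P-* p = P-resp (evalWith X X₁⁻¹ p) p (evalWith-X p) (P-eval p)
  where
  P-^ : ∀ p → P p → ∀ n → P (p ^R n)
  P-^ p h zero = P-const (+ 1)
  P-^ p h (suc n) = P-* p (p ^R n) h (P-^ p h n)
  P-pow₁ : ∀ e → P (pow₁ X X₁⁻¹ e)
  P-pow₁ (+ n) = P-^ (X 1) (P-X 0) n
  P-pow₁ -[1+ n ] = P-^ X₁⁻¹ P-X₁⁻¹ (suc n)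
  P-powRest : ∀ i es → P (powRest X X₁⁻¹ (suc i) es)
  P-powRest i [] = P-const (+ 1)
  P-powRest i (a ∷ as) = P-* (X (suc i) ^R a) (powRest X X₁⁻¹ (suc (suc i)) as) (P-^ (X (suc i)) (P-X i) a) (P-powRest (suc i) as)
  P-eval : ∀ p → P (evalWith X X₁⁻¹ p)
  P-eval [] = P-resp (const (+ 0)) 0R (zero-term 1M refl) (P-const (+ 0))
  P-eval ((c , mono e es) ∷ p) = P-+ (const c *R evalMono X X₁⁻¹ (mono e es)) (evalWith X X₁⁻¹ p)
    (P-* (const c) (evalMono X X₁⁻¹ (mono e es)) (P-const c)
      (P-* (pow₁ X X₁⁻¹ e) (powRest X X₁⁻¹ 2 es) (P-pow₁ e) (P-powRest 1 es)))
    (P-eval p)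

-- The inversion principle

module Inversion {c ℓ} (K : CommutativeRing c ℓ) where
  open CommutativeRing K hiding (refl; sym; trans; -_; _-_)
    renaming (Carrier to C; _≈_ to _~_; _+_ to _⊕_; _*_ to _⊗_)
  open NatSolver commutativeSemiring using (solve; _:=_) renaming (_:*_ to _⊠_; _:+_ to _⊞_)
  open SetoidReasoning setoid renaming (begin_ to begin~_; _∎ to _∎~)

  -- The complete interface on which the inversion rests: `a`, `b` and `v` stand for `A`, `bell` and
  -- `X₁⁻¹`. The value `x 1` in `φ-v` is the inverse of `A 1 1`, the image of `x 1` under `φ`.
  module _
    (const : ℤ → C) (x : ℕ → C) (v : C)
    (xv~1 : x 1 ⊗ v ~ 1#) (const-1 : const (- + 1) ⊗ const (- + 1) ~ 1#) (const1 : const (+ 1) ~ 1#)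
    (induction : (P : C → Set ℓ) → (∀ p q → p ~ q → P p → P q) →
      (∀ c → P (const c)) → (∀ i → P (x (suc i))) → P v →
      (∀ p q → P p → P q → P (p ⊕ q)) → (∀ p q → P p → P q → P (p ⊗ q)) → ∀ p → P p)
    (D : C → C) (D-cong : ∀ p q → p ~ q → D p ~ D q)
    (D-+ : ∀ p q → D (p ⊕ q) ~ D p ⊕ D q) (D-* : ∀ p q → D (p ⊗ q) ~ D p ⊗ q ⊕ p ⊗ D q)
    (D-0 : D 0# ~ 0#) (D-const : ∀ c → D (const c) ~ 0#)
    (D-x : ∀ i → D (x (suc i)) ~ x (suc (suc i))) (D-v : D v ~ const (- + 1) ⊗ (v ⊗ v ⊗ x 2))
    (a : ℕ → ℕ → C) (a-00 : a 0 0 ~ 1#) (a-0k : ∀ k → a 0 (suc k) ~ 0#) (a-n0 : ∀ n → a (suc n) 0 ~ 0#)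
    (a-rec : ∀ n k → a (suc n) (suc k) ~ v ⊗ (a n k ⊕ D (a n (suc k))))
    (b : ℕ → ℕ → C) (b-00 : b 0 0 ~ 1#) (b-0k : ∀ k → b 0 (suc k) ~ 0#) (b-n0 : ∀ n → b (suc n) 0 ~ 0#)
    (b-rec : ∀ n k → b (suc n) (suc k) ~ x 1 ⊗ b n k ⊕ D (b n (suc k)))
    (φ : C → C) (φ-cong : ∀ p q → p ~ q → φ p ~ φ q)
    (φ-+ : ∀ p q → φ (p ⊕ q) ~ φ p ⊕ φ q) (φ-* : ∀ p q → φ (p ⊗ q) ~ φ p ⊗ φ q)
    (φ-0 : φ 0# ~ 0#) (φ-const : ∀ c → φ (const c) ~ const c)
    (φ-x : ∀ i → φ (x (suc i)) ~ a (suc i) 1) (φ-v : φ v ~ x 1)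
    where

    private
      ~-refl : ∀ {p} → p ~ p
      ~-refl = CommutativeRing.refl K
      ~-trans : ∀ {p q r} → p ~ q → q ~ r → p ~ r
      ~-trans = CommutativeRing.trans K
      ~-sym : ∀ {p q} → p ~ q → q ~ p
      ~-sym = CommutativeRing.sym K

    a-11 : a 1 1 ~ v
    a-11 = begin~
      a 1 1                        ≈⟨ a-rec 0 0 ⟩
      v ⊗ (a 0 0 ⊕ D (a 0 1))      ≈⟨ *-congˡ (+-cong a-00 (~-trans (D-cong _ _ (a-0k 0)) D-0)) ⟩
      v ⊗ (1# ⊕ 0#)                ≈⟨ ~-trans (*-congˡ (+-identityʳ 1#)) (*-identityʳ v) ⟩
      v                            ∎~

    a-step : ∀ i → a (suc (suc i)) 1 ~ v ⊗ D (a (suc i) 1)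
    a-step i = ~-trans (a-rec (suc i) 0) (*-congˡ (~-trans (+-congʳ (a-n0 i)) (+-identityˡ _)))

    -- φ ∘ D and v · (D ∘ φ) are both derivations along φ, so it is enough to compare them on generators.
    φ-D : ∀ p → φ (D p) ~ v ⊗ D (φ p)
    φ-D = induction (λ p → φ (D p) ~ v ⊗ D (φ p))
      (λ p q h k → ~-trans (φ-cong _ _ (D-cong _ _ (~-sym h))) (~-trans k (*-congˡ (D-cong _ _ (φ-cong _ _ h)))))
      (λ c → begin~
        φ (D (const c))       ≈⟨ ~-trans (φ-cong _ _ (D-const c)) φ-0 ⟩
        0#                    ≈⟨ zeroʳ v ⟨
        v ⊗ 0#                ≈⟨ *-congˡ (~-trans (D-cong _ _ (φ-const c)) (D-const c)) ⟨
        v ⊗ D (φ (const c))   ∎~)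
      (λ i → begin~
        φ (D (x (suc i)))     ≈⟨ ~-trans (φ-cong _ _ (D-x i)) (φ-x (suc i)) ⟩
        a (suc (suc i)) 1     ≈⟨ a-step i ⟩
        v ⊗ D (a (suc i) 1)   ≈⟨ *-congˡ (D-cong _ _ (φ-x i)) ⟨
        v ⊗ D (φ (x (suc i))) ∎~)
      φ-D-v
      (λ p q hp hq → begin~
        φ (D (p ⊕ q))                        ≈⟨ ~-trans (φ-cong _ _ (D-+ p q)) (φ-+ _ _) ⟩
        φ (D p) ⊕ φ (D q)                    ≈⟨ +-cong hp hq ⟩
        v ⊗ D (φ p) ⊕ v ⊗ D (φ q)            ≈⟨ distribˡ v _ _ ⟨
        v ⊗ (D (φ p) ⊕ D (φ q))              ≈⟨ *-congˡ (~-trans (D-cong _ _ (φ-+ p q)) (D-+ _ _)) ⟨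
        v ⊗ D (φ (p ⊕ q))                    ∎~)
      (λ p q hp hq → begin~
        φ (D (p ⊗ q))                        ≈⟨ ~-trans (φ-cong _ _ (D-* p q)) (φ-+ _ _) ⟩
        φ (D p ⊗ q) ⊕ φ (p ⊗ D q)            ≈⟨ +-cong (φ-* _ _) (φ-* _ _) ⟩
        φ (D p) ⊗ φ q ⊕ φ p ⊗ φ (D q)        ≈⟨ +-cong (*-congʳ hp) (*-congˡ hq) ⟩
        v ⊗ D (φ p) ⊗ φ q ⊕ φ p ⊗ (v ⊗ D (φ q))
          ≈⟨ solve 5 (λ v p q d e → v ⊠ d ⊠ q ⊞ p ⊠ (v ⊠ e) := v ⊠ (d ⊠ q ⊞ p ⊠ e)) ~-refl v (φ p) (φ q) (D (φ p)) (D (φ q)) ⟩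
        v ⊗ (D (φ p) ⊗ φ q ⊕ φ p ⊗ D (φ q))  ≈⟨ *-congˡ (~-trans (D-cong _ _ (φ-* p q)) (D-* _ _)) ⟨
        v ⊗ D (φ (p ⊗ q))                    ∎~)
      where
      k = const (- + 1)
      -- The inverse `v` is a generator of its own and is checked by computation: `a 2 1` is
      -- `v D v`, that is, `k` times `v` cubed times `x 2`. The two factors `k` cancel, and so do
      -- two pairs `x 1 ⊗ v`, leaving `v ⊗ x 2`.
      φ-D-v : φ (D v) ~ v ⊗ D (φ v)
      φ-D-v = begin~
        φ (D v)                              ≈⟨ φ-cong _ _ D-v ⟩
        φ (k ⊗ (v ⊗ v ⊗ x 2))                ≈⟨ ~-trans (φ-* _ _) (*-cong (φ-const _) (~-trans (φ-* _ _) (*-cong (φ-* _ _) (φ-x 1)))) ⟩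
        k ⊗ (φ v ⊗ φ v ⊗ a 2 1)              ≈⟨ *-congˡ (*-cong (*-cong φ-v φ-v) (~-trans (a-step 0) (*-congˡ (~-trans (D-cong _ _ a-11) D-v)))) ⟩
        k ⊗ (x 1 ⊗ x 1 ⊗ (v ⊗ (k ⊗ (v ⊗ v ⊗ x 2))))
          ≈⟨ solve 4 (λ k x v y → k ⊠ (x ⊠ x ⊠ (v ⊠ (k ⊠ (v ⊠ v ⊠ y)))) := (k ⊠ k) ⊠ ((x ⊠ v) ⊠ ((x ⊠ v) ⊠ (v ⊠ y)))) ~-refl k (x 1) v (x 2) ⟩
        (k ⊗ k) ⊗ ((x 1 ⊗ v) ⊗ ((x 1 ⊗ v) ⊗ (v ⊗ x 2)))
          ≈⟨ *-cong const-1 (*-cong xv~1 (*-congʳ xv~1)) ⟩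
        1# ⊗ (1# ⊗ (1# ⊗ (v ⊗ x 2)))         ≈⟨ ~-trans (*-identityˡ _) (~-trans (*-identityˡ _) (*-identityˡ _)) ⟩
        v ⊗ x 2                              ≈⟨ *-congˡ (~-trans (D-cong _ _ φ-v) (D-x 0)) ⟨
        v ⊗ D (φ v)                          ∎~

    φ-a : ∀ i → φ (a (suc i) 1) ~ x (suc i)
    φ-a zero = ~-trans (φ-cong _ _ a-11) φ-v
    φ-a (suc i) = begin~
      φ (a (suc (suc i)) 1)              ≈⟨ ~-trans (φ-cong _ _ (a-step i)) (φ-* _ _) ⟩
      φ v ⊗ φ (D (a (suc i) 1))          ≈⟨ *-cong φ-v (φ-D _) ⟩
      x 1 ⊗ (v ⊗ D (φ (a (suc i) 1)))    ≈⟨ *-assoc _ _ _ ⟨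
      (x 1 ⊗ v) ⊗ D (φ (a (suc i) 1))    ≈⟨ *-cong xv~1 (D-cong _ _ (φ-a i)) ⟩
      1# ⊗ D (x (suc i))                 ≈⟨ ~-trans (*-identityˡ _) (D-x i) ⟩
      x (suc (suc i))                    ∎~

    φ-involutive : ∀ p → φ (φ p) ~ p
    φ-involutive = induction (λ p → φ (φ p) ~ p)
      (λ p q h k → ~-trans (φ-cong _ _ (φ-cong _ _ (~-sym h))) (~-trans k h))
      (λ c → ~-trans (φ-cong _ _ (φ-const c)) (φ-const c))
      (λ i → ~-trans (φ-cong _ _ (φ-x i)) (φ-a i))
      (~-trans (φ-cong _ _ φ-v) (~-trans (φ-x 0) a-11))
      (λ p q hp hq → ~-trans (φ-cong _ _ (φ-+ p q)) (~-trans (φ-+ _ _) (+-cong hp hq)))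
      (λ p q hp hq → ~-trans (φ-cong _ _ (φ-* p q)) (~-trans (φ-* _ _) (*-cong hp hq)))

    -- The induction on `n` treats all `k` at once: the recursion leads to the columns `k` and
    -- `suc k`, hence also to column 0 and beyond the diagonal.
    φ-b : ∀ n k → φ (b n k) ~ a n k
    φ-b zero zero = begin~
      φ (b 0 0)       ≈⟨ φ-cong _ _ (~-trans b-00 (~-sym const1)) ⟩
      φ (const (+ 1)) ≈⟨ ~-trans (φ-const _) const1 ⟩
      1#              ≈⟨ a-00 ⟨
      a 0 0           ∎~
    φ-b zero (suc k) = ~-trans (φ-cong _ _ (b-0k k)) (~-trans φ-0 (~-sym (a-0k k)))
    φ-b (suc n) zero = ~-trans (φ-cong _ _ (b-n0 n)) (~-trans φ-0 (~-sym (a-n0 n)))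
    φ-b (suc n) (suc k) = begin~
      φ (b (suc n) (suc k))                    ≈⟨ ~-trans (φ-cong _ _ (b-rec n k)) (φ-+ _ _) ⟩
      φ (x 1 ⊗ b n k) ⊕ φ (D (b n (suc k)))    ≈⟨ +-cong (φ-* _ _) (φ-D _) ⟩
      φ (x 1) ⊗ φ (b n k) ⊕ v ⊗ D (φ (b n (suc k)))
        ≈⟨ +-cong (*-cong (~-trans (φ-x 0) a-11) (φ-b n k)) (*-congˡ (D-cong _ _ (φ-b n (suc k)))) ⟩
      v ⊗ a n k ⊕ v ⊗ D (a n (suc k))          ≈⟨ distribˡ v _ _ ⟨
      v ⊗ (a n k ⊕ D (a n (suc k)))            ≈⟨ a-rec n k ⟨
      a (suc n) (suc k)                        ∎~

    φ-exchanges : ∀ n k → φ (b n k) ~ a n k × φ (a n k) ~ b n k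
    φ-exchanges n k = φ-b n k , ~-trans (φ-cong _ _ (~-sym (φ-b n k))) (φ-involutive (b n k))

-- The recursion for A

*R-zeroʳ : ∀ p → p *R [] ≡ []
*R-zeroʳ [] = refl
*R-zeroʳ (_ ∷ p) = *R-zeroʳ p

∂-[] : ∀ j → ∂ j [] ≡ []
∂-[] zero = refl
∂-[] (suc zero) = refl
∂-[] (suc (suc j)) = refl

D≤-[] : ∀ N → D≤ N [] ≡ []
D≤-[] zero = refl
D≤-[] (suc N) = cong₂ _++_ (D≤-[] N) (trans (cong (X (suc (suc N)) *R_) (∂-[] (suc N))) (*R-zeroʳ (X (suc (suc N)))))

S-vanish : ∀ n k → n < k → S n k ≡ []
S-vanish zero (suc k) h = refl
S-vanish (suc n) (suc k) h with suc k ℕ.≤? suc n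
... | no _ = refl
... | yes k≤n = contradiction k≤n (ℕ.<⇒≱ h)

bound-++ : ∀ N p q → bound p ≤ N → bound q ≤ N → bound (p ++ q) ≤ N
bound-++ N [] q hp hq = hq
bound-++ N ((c , mono e es) ∷ p) q hp hq = ℕ.⊔-lub (ℕ.m⊔n≤o⇒m≤o _ (bound p) hp)
  (bound-++ N p q (ℕ.m⊔n≤o⇒n≤o (suc (length es)) (bound p) hp) hq)

length-addExp : ∀ xs ys → length (addExp xs ys) ≡ length xs ℕ.⊔ length ys
length-addExp [] ys = refl
length-addExp (x ∷ xs) [] = refl
length-addExp (x ∷ xs) (y ∷ ys) = cong suc (length-addExp xs ys)

bound-map : ∀ N (g : ℤ × Mono → ℤ × Mono) →
  (∀ c m → suc (length (Mono.es m)) ≤ N → suc (length (Mono.es (proj₂ (g (c , m))))) ≤ N) →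
  ∀ p → bound p ≤ N → bound (map g p) ≤ N
bound-map N g h [] hp = hp
bound-map N g h ((c , mono e es) ∷ p) hp = ℕ.⊔-lub (h c (mono e es) (ℕ.m⊔n≤o⇒m≤o _ (bound p) hp))
  (bound-map N g h p (ℕ.m⊔n≤o⇒n≤o (suc (length es)) (bound p) hp))

bound-* : ∀ N p q → bound p ≤ N → bound q ≤ N → bound (p *R q) ≤ N
bound-* N [] q hp hq = z≤n
bound-* N ((c , mono e es) ∷ p) q hp hq = bound-++ N (map _ q) (p *R q)
  (bound-map N _ (λ d m hm → subst (λ l → suc l ≤ N) (sym (length-addExp es (Mono.es m)))
    (ℕ.⊔-lub (ℕ.m⊔n≤o⇒m≤o _ (bound p) hp) hm)) q hq)
  (bound-* N p q (ℕ.m⊔n≤o⇒n≤o (suc (length es)) (bound p) hp) hq)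

length-decAt : ∀ i xs → length (decAt i xs) ≡ length xs
length-decAt i [] = refl
length-decAt zero (x ∷ xs) = refl
length-decAt (suc i) (x ∷ xs) = cong suc (length-decAt i xs)

bound-∂ : ∀ N j p → bound p ≤ N → bound (∂ j p) ≤ N
bound-∂ N zero p h = z≤n
bound-∂ N (suc zero) p h = bound-map N _ (λ _ _ k → k) p h
bound-∂ N (suc (suc i)) p h = bound-map N _
  (λ _ m k → subst (λ l → suc l ≤ N) (sym (length-decAt i (Mono.es m))) k) p h

bound-D≤ : ∀ N M p → suc M ≤ N → bound p ≤ N → bound (D≤ M p) ≤ N
bound-D≤ N zero p hM hp = z≤n
bound-D≤ N (suc M) p hM hp = bound-++ N (D≤ M p) (X (suc (suc M)) *R ∂ (suc M) p)
  (bound-D≤ N M p (ℕ.≤-trans (ℕ.n≤1+n _) hM) hp)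
  (bound-* N (X (suc (suc M))) (∂ (suc M) p)
    (subst (_≤ N) (sym (bound-X (suc M))) hM) (bound-∂ N (suc M) p hp))

S-next : ℕ → R → R → R → R
S-next n s s' d = (const (- (+ (2 ℕ.* n) - + 1)) *R X 2 *R s) +R X 1 *R (s' +R d)

bound-S-next : ∀ N n s s' M → bound s' ≤ suc N → suc M ≤ suc N → 2 ≤ suc N → bound s ≤ suc N →
  bound (S-next n s s' (D≤ M s)) ≤ suc N
bound-S-next N n s s' M hs' hM h2 hs = bound-++ (suc N) (const c *R X 2 *R s) (X 1 *R (s' +R D≤ M s))
  (bound-* (suc N) (const c *R X 2) s h2 hs)
  (bound-* (suc N) (X 1) (s' +R D≤ M s) (s≤s z≤n)
    (bound-++ (suc N) s' (D≤ M s) hs' (bound-D≤ (suc N) M s hM hs)))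
  where c = - (+ (2 ℕ.* n) - + 1)

-- Only `X 1` up to `X (n - k + 1)` occur in `S n k`, so the finite sum in the recursion for `S` is
-- already the full derivation `D`. In the induction step the highest variable introduced,
-- `X (suc j)` for the last `j`, just meets the new bound.
bound-S : ∀ n k → k ≤ n → bound (S n k) ≤ suc (n ℕ.∸ k)
bound-S zero zero h = s≤s z≤n
bound-S (suc n) zero h = z≤n
bound-S (suc n) (suc k) (s≤s k≤n) with suc k ℕ.≤? suc n
... | no _ = z≤n
... | yes _ with suc k ℕ.≤? n
-- This is the diagonal `k = n`. The bound leaves no room for `X 2` here, but its cofactor
-- `S n (suc k)` is empty.
...   | no n≱k rewrite S-vanish n (suc k) (ℕ.≰⇒> n≱k) | D≤-[] (n ℕ.∸ suc k ℕ.+ 1) =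
        bound-* (suc (n ℕ.∸ k)) (X 1) (S n k +R []) (s≤s z≤n)
          (bound-++ (suc (n ℕ.∸ k)) (S n k) [] (bound-S n k k≤n) z≤n)
...   | yes k<n = bound-S-next (n ℕ.∸ k) n (S n (suc k)) (S n k) (n ℕ.∸ suc k ℕ.+ 1)
        (bound-S n k k≤n) (s≤s (ℕ.≤-reflexive (trans (ℕ.+-comm _ 1) suc-∸)))
        (s≤s (subst (1 ≤_) suc-∸ (s≤s z≤n)))
        (ℕ.≤-trans (bound-S n (suc k) k<n) (s≤s (ℕ.∸-monoʳ-≤ n (ℕ.n≤1+n k))))
  where
  suc-∸ : suc (n ℕ.∸ suc k) ≡ n ℕ.∸ k
  suc-∸ = sym (ℕ.+-∸-assoc 1 k<n)

D≤-S : ∀ n k → D≤ (n ℕ.∸ k ℕ.+ 1) (S n k) ≈ D (S n k)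
D≤-S n k with k ℕ.≤? n
... | yes k≤n = D≤-stable (n ℕ.∸ k ℕ.+ 1) (S n k)
                  (subst (bound (S n k) ≤_) (ℕ.+-comm 1 (n ℕ.∸ k)) (bound-S n k k≤n))
... | no k≰n rewrite S-vanish n k (ℕ.≰⇒> k≰n) | D≤-[] (n ℕ.∸ k ℕ.+ 1) = λ _ → refl

-- The coefficient of `X 2` in the recursion for `S` is the exponent `e` of the prefactor in row
-- `n`, so that summand comes from differentiating the prefactor. The exponent in row `n + 1` is
-- smaller by 2: one factor `X₁⁻¹` cancels the `X 1` of the recursion and the other remains in
-- front.
A-rec : ∀ n k → A (suc n) (suc k) ≈ X₁⁻¹ *R (A n k +R D (A n (suc k)))
A-rec n k with suc k ℕ.≤? suc n
... | no k≰n rewrite S-vanish n k (ℕ.≤-pred (ℕ.≰⇒> k≰n))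
                   | S-vanish n (suc k) (ℕ.m≤n⇒m≤1+n (ℕ.≤-pred (ℕ.≰⇒> k≰n))) = λ _ → refl
... | yes _ = L.rescale (X 1) X₁⁻¹ u (const e) (X 2) (S n (suc k)) (S n k) (D (S n (suc k)))
    {X₁^ (- (+ (2 ℕ.* suc n) - + 1))} {D≤ (n ℕ.∸ suc k ℕ.+ 1) (S n (suc k))} {D u} {D (u *R S n (suc k))}
    X₁-unit
    (monomial-cong (mono (- (+ (2 ℕ.* suc n) - + 1)) []) (mono (e + - + 1 + - + 1) []) (exponent , λ _ → refl))
    (D≤-S n (suc k)) (D-X₁^ e) (D-* u (S n (suc k)))
  where
  e = - (+ (2 ℕ.* n) - + 1)
  u = X₁^ e
  exponent : - (+ (2 ℕ.* suc n) - + 1) ≡ e + - + 1 + - + 1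
  exponent = trans (cong (λ a → - (+ a - + 1)) (ℕ.*-distribˡ-+ 2 1 n)) (step (+ (2 ℕ.* n)))
    where
    step : ∀ a → - (+ 2 + a - + 1) ≡ - (a - + 1) + - + 1 + - + 1
    step = solve-∀

A-00 : A 0 0 ≈ 1R
A-00 _ = refl

-- Taking the recursion as the definition keeps partitions out of the inversion argument; the
-- agreement with the closed sum `B` becomes a separate question about coefficients.
bell : ℕ → ℕ → R
bell zero zero = 1R
bell zero (suc k) = 0R
bell (suc n) zero = 0R
bell (suc n) (suc k) = X 1 *R bell n k +R D (bell n (suc k))

module Φ = Evaluation (λ i → A i 1) (X 1) A₁₁-unit

D-X₁⁻¹ : D X₁⁻¹ ≈ const (- + 1) *R (X₁⁻¹ *R X₁⁻¹ *R X 2)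
D-X₁⁻¹ _ = refl

inversion : ∀ n k → Φ.φ (bell n k) ≈ A n k × Φ.φ (A n k) ≈ bell n k
inversion = Inversion.φ-exchanges commutativeRing
  const X X₁⁻¹ X₁-unit (λ _ → refl) (λ _ → refl) R-induction
  D D-cong D-+ D-* (λ _ → refl) D-const D-X D-X₁⁻¹
  A A-00 (λ _ _ → refl) (λ _ _ → refl) A-rec
  bell (λ _ → refl) (λ _ _ → refl) (λ _ _ → refl) (λ _ _ _ → refl)
  Φ.φ Φ.φ-cong Φ.φ-+ Φ.φ-* (λ _ → refl) Φ.φ-const Φ.φ-X Φ.φ-X₁⁻¹

-- Coefficients of the Bell polynomials

sameMono-congʳ : ∀ m {n n'} → n ≋ n' → sameMono m n ≡ sameMono m n'
sameMono-congʳ m {n} {n'} h with sameMono m n | sameMono-reflects m n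
... | _ | ofʸ a = det (ofʸ (≋-trans a h)) (sameMono-reflects m n')
... | _ | ofⁿ a = det (ofⁿ λ b → a (≋-trans b (≋-sym h))) (sameMono-reflects m n')

coeff-cong : ∀ p {m m'} → m ≋ m' → coeff p m ≡ coeff p m'
coeff-cong [] h = refl
coeff-cong ((c , n) ∷ p) h = cong₂ (λ b x → (if b then c else + 0) + x) (sameMono-congʳ n h) (coeff-cong p h)

δ-yes : ∀ {m₀ m} → m ≋ m₀ → δ m₀ m ≡ + 1
δ-yes {m₀} {m} h with sameMono m m₀ | sameMono-reflects m m₀
... | true | _ = refl
... | false | ofⁿ k = contradiction h k

δ-no : ∀ {m₀ m} → ¬ m ≋ m₀ → δ m₀ m ≡ + 0
δ-no {m₀} {m} h with sameMono m m₀ | sameMono-reflects m m₀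
... | false | _ = refl
... | true | ofʸ k = contradiction k h

δ-iff : ∀ {m m₀ n n₀} → (m ≋ m₀ → n ≋ n₀) → (n ≋ n₀ → m ≋ m₀) → δ m₀ m ≡ δ n₀ n
δ-iff {m} {m₀} f g with sameMono m m₀ | sameMono-reflects m m₀
... | _ | ofʸ a = sym (δ-yes (f a))
... | _ | ofⁿ a = sym (δ-no (λ b → a (g b)))

mulMono-cancelˡ : ∀ u m n → mulMono u m ≋ mulMono u n → m ≋ n
mulMono-cancelˡ (mono e xs) (mono f ys) (mono g zs) (p , q) =
  ∙-cancelˡ e f g p , λ i → ℕ.+-cancelˡ-≡ (lookup0 xs i) _ _
    (trans (sym (lookup-addExp xs ys i)) (trans (q i) (lookup-addExp xs zs i)))

coeff-monomial* : ∀ u p m → coeff (monomial u *R p) m ≡ lin (λ n → δ m (mulMono u n)) p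
coeff-monomial* u p m = begin
  coeff (monomial u *R p) m                    ≡⟨ coeff-lin (monomial u *R p) m ⟩
  lin (δ m) (monomial u *R p)                  ≡⟨ lin-* (δ m) (monomial u) p ⟩
  + 1 * lin (λ n → δ m (mulMono u n)) p + + 0  ≡⟨ trans (ℤ.+-identityʳ _) (ℤ.*-identityˡ _) ⟩
  lin (λ n → δ m (mulMono u n)) p              ∎

coeff-cancel : ∀ u p m → coeff (monomial u *R p) (mulMono u m) ≡ coeff p m
coeff-cancel u p m = begin
  coeff (monomial u *R p) (mulMono u m)        ≡⟨ coeff-monomial* u p (mulMono u m) ⟩
  lin (λ n → δ (mulMono u m) (mulMono u n)) p
    ≡⟨ lin-ext (λ n → δ-iff (mulMono-cancelˡ u n m) (mulMono-cong (≋-refl {u}))) p ⟩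
  lin (δ m) p                                  ≡⟨ coeff-lin p m ⟨
  coeff p m                                    ∎

coeff-indivisible : ∀ u p m → (∀ n → ¬ mulMono u n ≋ m) → coeff (monomial u *R p) m ≡ + 0
coeff-indivisible u p m h = begin
  coeff (monomial u *R p) m                    ≡⟨ coeff-monomial* u p m ⟩
  lin (λ n → δ m (mulMono u n)) p              ≡⟨ lin-ext (λ n → δ-no (h n)) p ⟩
  lin (λ _ → + 0) p                            ≡⟨ lin-0 p ⟩
  + 0                                          ∎

-- The index is shifted by one: `var i` is the monomial of `X (suc i)`, in step with `∂ (suc i)`.
var : ℕ → Mono
var zero = mono (+ 1) []
var (suc i) = mono (+ 0) (unitExp i)

addExp-unitExp-decAt : ∀ i xs → ¬ lookup0 xs i ≡ 0 → addExp (unitExp i) (decAt i xs) ≐ xs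
addExp-unitExp-decAt i [] h = contradiction refl h
addExp-unitExp-decAt zero (zero ∷ xs) h = contradiction refl h
addExp-unitExp-decAt zero (suc x ∷ xs) h j = refl
addExp-unitExp-decAt (suc i) (x ∷ xs) h zero = refl
addExp-unitExp-decAt (suc i) (x ∷ xs) h (suc j) = addExp-unitExp-decAt i xs h j

var-dmono : ∀ i m → ¬ dcoef (suc i) m ≡ + 0 → mulMono (var i) (dmono (suc i) m) ≋ m
var-dmono zero (mono e es) h = step e , λ _ → refl
  where
  step : ∀ e → + 1 + (e - + 1) ≡ e
  step = solve-∀
var-dmono (suc i) (mono e es) h = ℤ.+-identityˡ e , addExp-unitExp-decAt i es (λ k → h (cong +_ k))

dcoef-var : ∀ i → dcoef (suc i) (var i) ≡ + 1
dcoef-var zero = refl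
dcoef-var (suc i) = cong +_ (lookup-unitExp-self i)

-- Among the monomials in which the exponent of `X (suc i)` is nonzero, only `mulMono (var i) m`
-- differentiates to a multiple of `m`, and its exponent exceeds that of `m` by one.
coeff-∂ : ∀ i p m → coeff (∂ (suc i) p) m ≡ (+ 1 + dcoef (suc i) m) * coeff p (mulMono (var i) m)
coeff-∂ i p m = begin
  coeff (∂ (suc i) p) m
    ≡⟨ coeff-lin (∂ (suc i) p) m ⟩
  lin (δ m) (∂ (suc i) p)
    ≡⟨ lin-∂ (δ m) (suc i) p ⟩
  lin (λ n → dcoef (suc i) n * δ m (dmono (suc i) n)) p
    ≡⟨ lin-ext term p ⟩
  lin (λ n → (+ 1 + dcoef (suc i) m) * δ (mulMono (var i) m) n) p
    ≡⟨ lin-scale (+ 1 + dcoef (suc i) m) (δ (mulMono (var i) m)) p ⟩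
  (+ 1 + dcoef (suc i) m) * lin (δ (mulMono (var i) m)) p
    ≡⟨ cong ((+ 1 + dcoef (suc i) m) *_) (coeff-lin p (mulMono (var i) m)) ⟨
  (+ 1 + dcoef (suc i) m) * coeff p (mulMono (var i) m) ∎
  where
  dcoef-up : ∀ n → n ≋ mulMono (var i) m → dcoef (suc i) n ≡ + 1 + dcoef (suc i) m
  dcoef-up n h = trans (dcoef-cong (suc i) h)
    (trans (dcoef-mul (suc i) (var i) m) (cong (_+ dcoef (suc i) m) (dcoef-var i)))
  term : ∀ n → dcoef (suc i) n * δ m (dmono (suc i) n) ≡ (+ 1 + dcoef (suc i) m) * δ (mulMono (var i) m) n
  term n with sameMono n (mulMono (var i) m) | sameMono-reflects n (mulMono (var i) m) | dcoef (suc i) n ℤ.≟ + 0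
  -- For `i = 0` this case does occur, since exponents of `X 1` are integers: `m` then has exponent
  -- -1, and `1 + dcoef (suc i) m` is zero as well.
  ... | true | ofʸ h | yes z = begin
    dcoef (suc i) n * δ m (dmono (suc i) n)  ≡⟨ cong (_* δ m (dmono (suc i) n)) z ⟩
    + 0                                      ≡⟨ z ⟨
    dcoef (suc i) n                          ≡⟨ dcoef-up n h ⟩
    + 1 + dcoef (suc i) m                    ≡⟨ ℤ.*-identityʳ _ ⟨
    (+ 1 + dcoef (suc i) m) * + 1            ∎
  ... | true | ofʸ h | no nz = cong₂ _*_ (dcoef-up n h)
    (δ-yes (mulMono-cancelˡ (var i) (dmono (suc i) n) m (≋-trans (var-dmono i n nz) h)))
  ... | false | _ | yes z = trans (cong (_* δ m (dmono (suc i) n)) z) (sym (ℤ.*-zeroʳ (+ 1 + dcoef (suc i) m)))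
  ... | false | ofⁿ h | no nz = begin
    dcoef (suc i) n * δ m (dmono (suc i) n)
      ≡⟨ cong (dcoef (suc i) n *_) (δ-no (λ k → h (≋-trans (≋-sym (var-dmono i n nz)) (mulMono-cong (≋-refl {var i}) k)))) ⟩
    dcoef (suc i) n * + 0          ≡⟨ ℤ.*-zeroʳ (dcoef (suc i) n) ⟩
    + 0                            ≡⟨ ℤ.*-zeroʳ (+ 1 + dcoef (suc i) m) ⟨
    (+ 1 + dcoef (suc i) m) * + 0  ∎

coeff-X₁* : ∀ p e es → coeff (X 1 *R p) (mono e es) ≡ coeff p (mono (e - + 1) es)
coeff-X₁* p e es = trans (coeff-cong (X 1 *R p) (step e , λ _ → refl)) (coeff-cancel (var 0) p (mono (e - + 1) es))
  where
  step : ∀ e → e ≡ + 1 + (e - + 1)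
  step = solve-∀

X∂ : ℕ → R → R
X∂ i p = X (suc (suc i)) *R ∂ (suc i) p

coeff-X∂-zero : ∀ i p e es → lookup0 es i ≡ 0 → coeff (X∂ i p) (mono e es) ≡ + 0
coeff-X∂-zero i p e es h = coeff-indivisible (var (suc i)) (∂ (suc i) p) (mono e es)
  λ n k → ℕ.1+n≢0 (trans (cong (ℕ._+ lookup0 (Mono.es n) i) (sym (lookup-unitExp-self i)))
    (trans (sym (lookup-addExp (unitExp i) (Mono.es n) i)) (trans (es-≐ k i) h)))

coeff-X∂ : ∀ i p e es → ¬ lookup0 es i ≡ 0 → coeff (X∂ i p) (mono e es)
  ≡ (+ 1 + dcoef (suc i) (mono e (decAt i es))) * coeff p (mulMono (var i) (mono e (decAt i es)))
coeff-X∂ i p e es h = begin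
  coeff (X∂ i p) (mono e es)
    ≡⟨ coeff-cong (X∂ i p) (≋-sym (var-dmono (suc i) (mono e es) (λ k → h (ℤ.+-injective k)))) ⟩
  coeff (X∂ i p) (mulMono (var (suc i)) m)
    ≡⟨ coeff-cancel (var (suc i)) (∂ (suc i) p) m ⟩
  coeff (∂ (suc i) p) m
    ≡⟨ coeff-∂ i p m ⟩
  (+ 1 + dcoef (suc i) m) * coeff p (mulMono (var i) m) ∎
  where m = mono e (decAt i es)

coeff-++ : ∀ p q m → coeff (p +R q) m ≡ coeff p m + coeff q m
coeff-++ p q m = trans (coeff-lin (p +R q) m) (trans (lin-++ (δ m) p q)
  (sym (cong₂ _+_ (coeff-lin p m) (coeff-lin q m))))

-- `monoOf` reaches only nonnegative exponents of `X 1`, so the other monomials need their own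
-- argument. Multiplication by `X 1` raises the exponent, and `∂ 1` cannot lower it past 0.
bell-negative : ∀ n k j es → coeff (bell n k) (mono -[1+ j ] es) ≡ + 0
bell-negative zero zero j es = refl
bell-negative zero (suc k) j es = refl
bell-negative (suc n) zero j es = refl
bell-negative (suc n) (suc k) j es = begin
  coeff (X 1 *R bell n k +R D p) m            ≡⟨ coeff-++ (X 1 *R bell n k) (D p) m ⟩
  coeff (X 1 *R bell n k) m + coeff (D p) m
    ≡⟨ cong₂ _+_ (trans (coeff-X₁* (bell n k) -[1+ j ] es) (bell-negative n k _ es)) (D≤-negative (bound p)) ⟩
  + 0 + + 0                                   ≡⟨⟩
  + 0                                         ∎
  where
  m = mono -[1+ j ] es
  p = bell n (suc k)
  term : ∀ i j es → (+ 1 + dcoef (suc i) (mono -[1+ j ] es)) * coeff p (mulMono (var i) (mono -[1+ j ] es)) ≡ + 0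
  -- The factor `1 + (-1)` vanishes: differentiation by `X 1` does not create `X₁⁻¹`.
  term zero zero es = refl
  term zero (suc j) es = trans (cong (-[1+ j ] *_) (bell-negative n (suc k) j es)) (ℤ.*-zeroʳ -[1+ j ])
  term (suc i) j es = trans (cong ((+ 1 + + lookup0 es i) *_) (bell-negative n (suc k) j _)) (ℤ.*-zeroʳ (+ 1 + + lookup0 es i))
  D≤-negative : ∀ N → coeff (D≤ N p) m ≡ + 0
  D≤-negative zero = refl
  D≤-negative (suc N) = trans (coeff-++ (D≤ N p) (X∂ N p) m) (cong₂ _+_ (D≤-negative N) X∂-negative)
    where
    X∂-negative : coeff (X∂ N p) m ≡ + 0
    X∂-negative with lookup0 es N ℕ.≟ 0
    ... | yes z = coeff-X∂-zero N p -[1+ j ] es z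
    ... | no nz = trans (coeff-X∂ N p -[1+ j ] es nz) (term N j (decAt N es))

-- Exponents of X_{i+1} · (monomial xs) / X_{i+2}, for a monomial divisible by X_{i+2}.
shift : ℕ → List ℕ → List ℕ
shift zero (a ∷ b ∷ xs) = suc a ∷ (b ℕ.∸ 1) ∷ xs
shift (suc i) (a ∷ xs) = a ∷ shift i xs
shift _ xs = xs

addExp-unitExp-shift : ∀ i xs → ¬ lookup0 xs (suc i) ≡ 0 → addExp (unitExp i) (decAt (suc i) xs) ≐ shift i xs
addExp-unitExp-shift i [] h = contradiction refl h
addExp-unitExp-shift zero (a ∷ []) h = contradiction refl h
addExp-unitExp-shift zero (a ∷ b ∷ xs) h zero = refl
addExp-unitExp-shift zero (a ∷ b ∷ xs) h (suc j) = refl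
addExp-unitExp-shift (suc i) (a ∷ xs) h zero = refl
addExp-unitExp-shift (suc i) (a ∷ xs) h (suc j) = addExp-unitExp-shift i xs h j

coeff-X∂-shift : ∀ i p xs → ¬ lookup0 xs (suc i) ≡ 0 →
  coeff (X∂ i p) (monoOf xs) ≡ + suc (lookup0 xs i) * coeff p (monoOf (shift i xs))
coeff-X∂-shift i p [] h = contradiction refl h
coeff-X∂-shift zero p (a ∷ []) h = contradiction refl h
coeff-X∂-shift zero p (a ∷ b ∷ xs) h = coeff-X∂ 0 p (+ a) (b ∷ xs) h
coeff-X∂-shift (suc i) p (a ∷ xs) h = trans (coeff-X∂ (suc i) p (+ a) xs h)
  (cong₂ (λ l c → + suc l * c)
    (lookup-decAt-pred i xs)
    (coeff-cong p (refl , addExp-unitExp-shift i xs h)))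
  where
  lookup-decAt-pred : ∀ i xs → lookup0 (decAt (suc i) xs) i ≡ lookup0 xs i
  lookup-decAt-pred i [] = refl
  lookup-decAt-pred zero (x ∷ xs) = refl
  lookup-decAt-pred (suc i) (x ∷ xs) = lookup-decAt-pred i xs

-- Three factors change when one part of size `s + i + 1` is replaced by one of size `s + i`: the
-- falling multiplicity loses `lookup0 xs (suc i)` from its factorial, the growing one gains
-- `suc (lookup0 xs i)`, and the factorials of the two part sizes have quotient `s + i + 1`.
denom-shift : ∀ s i xs → ¬ lookup0 xs (suc i) ≡ 0 →
  suc (lookup0 xs i) ℕ.* denom s xs ≡ lookup0 xs (suc i) ℕ.* (s ℕ.+ suc i) ℕ.* denom s (shift i xs)
denom-shift s i [] h = contradiction refl h
denom-shift s zero (a ∷ []) h = contradiction refl h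
denom-shift s zero (a ∷ zero ∷ xs) h = contradiction refl h
denom-shift s zero (a ∷ suc b ∷ xs) h =
  step s a b (a !) (b !) (s !) ((s !) ℕ.^ a) ((suc s !) ℕ.^ b) (denom (suc (suc s)) xs)
  where
  step : ∀ s a b a! b! s! u v w →
    suc a ℕ.* (a! ℕ.* u ℕ.* (suc b ℕ.* b! ℕ.* (suc s ℕ.* s! ℕ.* v) ℕ.* w))
      ≡ suc b ℕ.* (s ℕ.+ 1) ℕ.* (suc a ℕ.* a! ℕ.* (s! ℕ.* u) ℕ.* (b! ℕ.* v ℕ.* w))
  step = ℕ-Solver.solve-∀
denom-shift s (suc i) (a ∷ xs) h = begin
  suc (lookup0 xs i) ℕ.* (c ℕ.* denom (suc s) xs)
    ≡⟨ swap (suc (lookup0 xs i)) c (denom (suc s) xs) ⟩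
  c ℕ.* (suc (lookup0 xs i) ℕ.* denom (suc s) xs)
    ≡⟨ cong (c ℕ.*_) (denom-shift (suc s) i xs h) ⟩
  c ℕ.* (lookup0 xs (suc i) ℕ.* (suc s ℕ.+ suc i) ℕ.* denom (suc s) (shift i xs))
    ≡⟨ cong (λ t → c ℕ.* (lookup0 xs (suc i) ℕ.* t ℕ.* denom (suc s) (shift i xs))) (ℕ.+-suc s (suc i)) ⟨
  c ℕ.* (lookup0 xs (suc i) ℕ.* (s ℕ.+ suc (suc i)) ℕ.* denom (suc s) (shift i xs))
    ≡⟨ swap c (lookup0 xs (suc i) ℕ.* (s ℕ.+ suc (suc i))) (denom (suc s) (shift i xs)) ⟩
  lookup0 xs (suc i) ℕ.* (s ℕ.+ suc (suc i)) ℕ.* (c ℕ.* denom (suc s) (shift i xs)) ∎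
  where
  c = (a !) ℕ.* ((s !) ℕ.^ a)
  swap : ∀ x y z → x ℕ.* (y ℕ.* z) ≡ y ℕ.* (x ℕ.* z)
  swap = ℕ-Solver.solve-∀

sumL-shift : ∀ i xs → ¬ lookup0 xs (suc i) ≡ 0 → sumL (shift i xs) ≡ sumL xs
sumL-shift i [] h = contradiction refl h
sumL-shift zero (a ∷ []) h = contradiction refl h
sumL-shift zero (a ∷ zero ∷ xs) h = contradiction refl h
sumL-shift zero (a ∷ suc b ∷ xs) h = sym (ℕ.+-suc a (b ℕ.+ sumL xs))
sumL-shift (suc i) (a ∷ xs) h = cong (a ℕ.+_) (sumL-shift i xs h)

wsum-shift : ∀ s i xs → ¬ lookup0 xs (suc i) ≡ 0 → suc (wsum s (shift i xs)) ≡ wsum s xs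
wsum-shift s i [] h = contradiction refl h
wsum-shift s zero (a ∷ []) h = contradiction refl h
wsum-shift s zero (a ∷ zero ∷ xs) h = contradiction refl h
wsum-shift s zero (a ∷ suc b ∷ xs) h = step s a b (wsum (suc (suc s)) xs)
  where
  step : ∀ s a b w → suc (s ℕ.* suc a ℕ.+ (suc s ℕ.* b ℕ.+ w)) ≡ s ℕ.* a ℕ.+ (suc s ℕ.* suc b ℕ.+ w)
  step = ℕ-Solver.solve-∀
wsum-shift s (suc i) (a ∷ xs) h = trans (sym (ℕ.+-suc (s ℕ.* a) _)) (cong (s ℕ.* a ℕ.+_) (wsum-shift (suc s) i xs h))

-- The partial sums of `wsum`, built up in the order in which `D≤ N` adds its summands.
weight : ℕ → ℕ → List ℕ → ℕ
weight s zero xs = 0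
weight s (suc N) xs = weight s N xs ℕ.+ lookup0 xs N ℕ.* (s ℕ.+ N)

weight-wsum : ∀ s N xs → length xs ≤ N → weight s N xs ≡ wsum s xs
weight-wsum s N [] h = weight-[] N
  where
  weight-[] : ∀ N → weight s N [] ≡ 0
  weight-[] zero = refl
  weight-[] (suc N) = trans (ℕ.+-identityʳ _) (weight-[] N)
weight-wsum s (suc N) (x ∷ xs) (s≤s h) = trans (weight-∷ N) (cong (s ℕ.* x ℕ.+_) (weight-wsum (suc s) N xs h))
  where
  weight-∷ : ∀ N → weight s (suc N) (x ∷ xs) ≡ s ℕ.* x ℕ.+ weight (suc s) N xs
  weight-∷ zero = step s x
    where
    step : ∀ s x → x ℕ.* (s ℕ.+ 0) ≡ s ℕ.* x ℕ.+ 0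
    step = ℕ-Solver.solve-∀
  weight-∷ (suc N) = trans (cong (ℕ._+ lookup0 xs N ℕ.* (s ℕ.+ suc N)) (weight-∷ N))
    (step s x (weight (suc s) N xs) (lookup0 xs N) N)
    where
    step : ∀ s x w l N → s ℕ.* x ℕ.+ w ℕ.+ l ℕ.* (s ℕ.+ suc N) ≡ s ℕ.* x ℕ.+ (w ℕ.+ l ℕ.* (suc s ℕ.+ N))
    step = ℕ-Solver.solve-∀

-- The index conditions on exponent lists

isBell : ℕ → ℕ → List ℕ → Bool
isBell n k xs = (sumL xs ℕ.≡ᵇ k) ∧ (wsum 1 xs ℕ.≡ᵇ n)

χ : ℕ → ℕ → List ℕ → ℤ
χ n k xs = if isBell n k xs then + 1 else + 0

isBell-shift : ∀ n k i xs → ¬ lookup0 xs (suc i) ≡ 0 → isBell n k (shift i xs) ≡ isBell (suc n) k xs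
isBell-shift n k i xs h = cong₂ (λ a b → (a ℕ.≡ᵇ k) ∧ (b ℕ.≡ᵇ suc n)) (sumL-shift i xs h) (wsum-shift 1 i xs h)

sumL≡0⇒wsum≡0 : ∀ s xs → sumL xs ≡ 0 → wsum s xs ≡ 0
sumL≡0⇒wsum≡0 s [] h = refl
sumL≡0⇒wsum≡0 s (zero ∷ xs) h = trans (cong (ℕ._+ wsum (suc s) xs) (ℕ.*-zeroʳ s)) (sumL≡0⇒wsum≡0 (suc s) xs h)

wsum≡0⇒zero : ∀ s xs → wsum (suc s) xs ≡ 0 → xs ≐ []
wsum≡0⇒zero s [] h i = refl
wsum≡0⇒zero s (zero ∷ xs) h zero = refl
wsum≡0⇒zero s (zero ∷ xs) h (suc i) =
  wsum≡0⇒zero (suc s) xs (trans (cong (ℕ._+ wsum (suc (suc s)) xs) (sym (ℕ.*-zeroʳ s))) h) i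

sumL-cong : ∀ xs ys → xs ≐ ys → sumL xs ≡ sumL ys
sumL-cong xs ys h = trans (sumL-strip xs) (trans (cong sumL (strip-cong xs ys h)) (sym (sumL-strip ys)))
  where
  sumL-consZ : ∀ x xs → sumL (consZ x xs) ≡ x ℕ.+ sumL xs
  sumL-consZ zero [] = refl
  sumL-consZ zero (_ ∷ _) = refl
  sumL-consZ (suc x) xs = refl
  sumL-strip : ∀ xs → sumL xs ≡ sumL (strip xs)
  sumL-strip [] = refl
  sumL-strip (x ∷ xs) = trans (cong (x ℕ.+_) (sumL-strip xs)) (sym (sumL-consZ x (strip xs)))

wsum-cong : ∀ s xs ys → xs ≐ ys → wsum s xs ≡ wsum s ys
wsum-cong s xs ys h = trans (wsum-strip s xs) (trans (cong (wsum s) (strip-cong xs ys h)) (sym (wsum-strip s ys)))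
  where
  wsum-consZ : ∀ s x xs → wsum s (consZ x xs) ≡ s ℕ.* x ℕ.+ wsum (suc s) xs
  wsum-consZ s zero [] = sym (cong (ℕ._+ 0) (ℕ.*-zeroʳ s))
  wsum-consZ s zero (_ ∷ _) = refl
  wsum-consZ s (suc x) xs = refl
  wsum-strip : ∀ s xs → wsum s xs ≡ wsum s (strip xs)
  wsum-strip s [] = refl
  wsum-strip s (x ∷ xs) = trans (cong (s ℕ.* x ℕ.+_) (wsum-strip (suc s) xs)) (sym (wsum-consZ s x (strip xs)))

isBell-cong : ∀ n k xs ys → xs ≐ ys → isBell n k xs ≡ isBell n k ys
isBell-cong n k xs ys h = cong₂ (λ a b → (a ℕ.≡ᵇ k) ∧ (b ℕ.≡ᵇ n)) (sumL-cong xs ys h) (wsum-cong 1 xs ys h)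

≡ᵇ-reflects : ∀ a b → Reflects (a ≡ b) (a ℕ.≡ᵇ b)
≡ᵇ-reflects a b = fromEquivalence (ℕ.≡ᵇ⇒≡ a b) (ℕ.≡⇒≡ᵇ a b)

isBell-reflects : ∀ n k xs → Reflects (sumL xs ≡ k × wsum 1 xs ≡ n) (isBell n k xs)
isBell-reflects n k xs = ≡ᵇ-reflects (sumL xs) k ×-reflects ≡ᵇ-reflects (wsum 1 xs) n

denom-zero : ∀ s xs → xs ≐ [] → denom s xs ≡ 1
denom-zero s [] h = refl
denom-zero s (x ∷ xs) h rewrite h 0 = trans (ℕ.+-identityʳ _) (denom-zero (suc s) xs (λ i → h (suc i)))

e₁-monoOf : ∀ xs → Mono.e₁ (monoOf xs) ≡ + lookup0 xs 0
e₁-monoOf [] = refl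
e₁-monoOf (x ∷ xs) = refl

es-monoOf : ∀ xs i → lookup0 (Mono.es (monoOf xs)) i ≡ lookup0 xs (suc i)
es-monoOf [] i = refl
es-monoOf (x ∷ xs) i = refl

monoOf-cong : ∀ xs ys → xs ≐ ys → monoOf xs ≋ monoOf ys
monoOf-cong xs ys h = trans (e₁-monoOf xs) (trans (cong +_ (h 0)) (sym (e₁-monoOf ys)))
  , λ i → trans (es-monoOf xs i) (trans (h (suc i)) (sym (es-monoOf ys i)))

monoOf-injective : ∀ xs ys → monoOf xs ≋ monoOf ys → xs ≐ ys
monoOf-injective xs ys h zero = ℤ.+-injective (trans (sym (e₁-monoOf xs)) (trans (e₁-≡ h) (e₁-monoOf ys)))
monoOf-injective xs ys h (suc i) = trans (sym (es-monoOf xs i)) (trans (es-≐ h i) (es-monoOf ys i))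

coeff-1R-yes : ∀ m → 1M ≋ m → coeff 1R m ≡ + 1
coeff-1R-yes m h = trans (ℤ.+-identityʳ _) (δ-yes {m} {1M} h)

-- Multiplying out the denominator makes its divisibility of n ! a consequence instead of a prerequisite.
bell-coeff : ∀ n k xs → coeff (bell n k) (monoOf xs) * + denom 1 xs ≡ χ n k xs * + (n !)
bell-coeff zero zero xs with isBell 0 0 xs | isBell-reflects 0 0 xs
... | true | ofʸ (_ , w) = cong₂ _*_ (coeff-1R-yes (monoOf xs) (≋-sym (monoOf-cong xs [] z))) (cong +_ (denom-zero 1 xs z))
  where z = wsum≡0⇒zero 0 xs w
... | false | ofⁿ h = cong (_* + denom 1 xs) (trans (ℤ.+-identityʳ _) (δ-no {monoOf xs} {1M} not1))
  where
  not1 : ¬ 1M ≋ monoOf xs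
  not1 k = h (sumL-cong xs [] z , wsum-cong 1 xs [] z)
    where z = monoOf-injective xs [] (≋-sym k)
bell-coeff zero (suc k) xs with isBell 0 (suc k) xs | isBell-reflects 0 (suc k) xs
... | false | _ = refl
... | true | ofʸ (s , w) = contradiction (trans (sym s) (sumL-cong xs [] (wsum≡0⇒zero 0 xs w))) ℕ.1+n≢0
bell-coeff (suc n) zero xs with isBell (suc n) 0 xs | isBell-reflects (suc n) 0 xs
... | false | _ = refl
... | true | ofʸ (s , w) = contradiction (trans (sym w) (sumL≡0⇒wsum≡0 1 xs s)) ℕ.1+n≢0
bell-coeff (suc n) (suc k) xs = begin
  coeff (q +R D p) (monoOf xs) * d
    ≡⟨ cong (_* d) (+R-cong q q (D p) (D≤ N p) (λ _ → refl) (λ m → sym (D≤-stable N p (ℕ.m≤m⊔n (bound p) (length xs)) m)) (monoOf xs)) ⟩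
  coeff (q +R D≤ N p) (monoOf xs) * d
    ≡⟨ partial N ⟩
  + weight 1 (suc N) xs * (χ (suc n) (suc k) xs * + (n !))
    ≡⟨ cong (λ w → + w * (χ (suc n) (suc k) xs * + (n !)))
         (weight-wsum 1 (suc N) xs (ℕ.≤-trans (ℕ.m≤n⊔m (bound p) (length xs)) (ℕ.n≤1+n N))) ⟩
  + wsum 1 xs * (χ (suc n) (suc k) xs * + (n !))
    ≡⟨ factorial ⟩
  χ (suc n) (suc k) xs * + (suc n !) ∎
  where
  p = bell n (suc k)
  q = X 1 *R bell n k
  d = + denom 1 xs
  -- Large enough for both limits: beyond `bound p` the derivation is complete, and beyond
  -- `length xs` the partial weight is all of `wsum 1 xs`.
  N = bound p ℕ.⊔ length xs
  factorial : + wsum 1 xs * (χ (suc n) (suc k) xs * + (n !)) ≡ χ (suc n) (suc k) xs * + (suc n !)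
  factorial with isBell (suc n) (suc k) xs | isBell-reflects (suc n) (suc k) xs
  ... | false | _ = ℤ.*-zeroʳ (+ wsum 1 xs)
  ... | true | ofʸ (_ , w) = begin
    + wsum 1 xs * (+ 1 * + (n !))  ≡⟨ cong₂ (λ a b → + a * b) w (ℤ.*-identityˡ (+ (n !))) ⟩
    + suc n * + (n !)              ≡⟨ ℤ.pos-* (suc n) (n !) ⟨
    + (suc n !)                    ≡⟨ ℤ.*-identityˡ _ ⟨
    + 1 * + (suc n !)              ∎
  -- The summand `X 1 *R bell n k` and each summand of `D` contribute the same quantity `χ * n !`,
  -- multiplied by the share `j r_j` of one part size `j` in `wsum 1 xs`: size 1 in `first`, size
  -- `i + 2` in `next i`. The shares add up to `n + 1`, which turns `n !` into `suc n !`.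
  first : ∀ xs → coeff q (monoOf xs) * + denom 1 xs ≡ + lookup0 xs 0 * (χ (suc n) (suc k) xs * + (n !))
  first [] = cong (_* + 1) (trans (coeff-X₁* (bell n k) (+ 0) []) (bell-negative n k 0 []))
  first (zero ∷ xs) = cong (_* + denom 1 (0 ∷ xs)) (trans (coeff-X₁* (bell n k) (+ 0) xs) (bell-negative n k 0 xs))
  first (suc r ∷ xs) = begin
    coeff q (monoOf (suc r ∷ xs)) * + denom 1 (suc r ∷ xs)
      ≡⟨ cong₂ (λ a b → a * + b) (coeff-X₁* (bell n k) (+ suc r) xs) (step₁ r (r !) ((1 !) ℕ.^ r) (denom 2 xs)) ⟩
    c * + (suc r ℕ.* denom 1 (r ∷ xs))
      ≡⟨ cong (c *_) (ℤ.pos-* (suc r) (denom 1 (r ∷ xs))) ⟩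
    c * (+ suc r * + denom 1 (r ∷ xs))
      ≡⟨ step₂ c (+ suc r) (+ denom 1 (r ∷ xs)) ⟩
    + suc r * (c * + denom 1 (r ∷ xs))
      ≡⟨ cong (+ suc r *_) (bell-coeff n k (r ∷ xs)) ⟩
    + suc r * (χ n k (r ∷ xs) * + (n !)) ∎
    where
    c = coeff (bell n k) (monoOf (r ∷ xs))
    step₁ : ∀ r r! u w → suc r ℕ.* r! ℕ.* (1 ℕ.* u) ℕ.* w ≡ suc r ℕ.* (r! ℕ.* u ℕ.* w)
    step₁ = ℕ-Solver.solve-∀
    step₂ : ∀ a b c → a * (b * c) ≡ b * (a * c)
    step₂ = solve-∀
  next : ∀ i → coeff (X∂ i p) (monoOf xs) * d ≡ + (lookup0 xs (suc i) ℕ.* suc (suc i)) * (χ (suc n) (suc k) xs * + (n !))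
  next i with lookup0 xs (suc i) ℕ.≟ 0
  ... | yes z = trans (cong (_* d) (coeff-X∂-zero i p _ (Mono.es (monoOf xs)) (trans (es-monoOf xs i) z)))
                  (sym (cong (λ l → + (l ℕ.* suc (suc i)) * (χ (suc n) (suc k) xs * + (n !))) z))
  ... | no nz = begin
    coeff (X∂ i p) (monoOf xs) * d
      ≡⟨ cong (_* d) (coeff-X∂-shift i p xs nz) ⟩
    + suc (lookup0 xs i) * c * d
      ≡⟨ step₁ (+ suc (lookup0 xs i)) c d ⟩
    c * (+ suc (lookup0 xs i) * d)
      ≡⟨ cong (c *_) (ℤ.pos-* (suc (lookup0 xs i)) (denom 1 xs)) ⟨
    c * + (suc (lookup0 xs i) ℕ.* denom 1 xs)
      ≡⟨ cong (λ a → c * + a) (denom-shift 1 i xs nz) ⟩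
    c * + (l ℕ.* denom 1 (shift i xs))
      ≡⟨ cong (c *_) (ℤ.pos-* l (denom 1 (shift i xs))) ⟩
    c * (+ l * + denom 1 (shift i xs))
      ≡⟨ step₂ c (+ l) (+ denom 1 (shift i xs)) ⟩
    + l * (c * + denom 1 (shift i xs))
      ≡⟨ cong (+ l *_) (bell-coeff n (suc k) (shift i xs)) ⟩
    + l * (χ n (suc k) (shift i xs) * + (n !))
      ≡⟨ cong (λ b → + l * ((if b then + 1 else + 0) * + (n !))) (isBell-shift n (suc k) i xs nz) ⟩
    + l * (χ (suc n) (suc k) xs * + (n !)) ∎
    where
    c = coeff p (monoOf (shift i xs))
    l = lookup0 xs (suc i) ℕ.* suc (suc i)
    step₁ : ∀ a c d → a * c * d ≡ c * (a * d)
    step₁ = solve-∀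
    step₂ : ∀ a b c → a * (b * c) ≡ b * (a * c)
    step₂ = solve-∀
  partial : ∀ N → coeff (q +R D≤ N p) (monoOf xs) * d ≡ + weight 1 (suc N) xs * (χ (suc n) (suc k) xs * + (n !))
  partial zero = begin
    coeff (q +R 0R) (monoOf xs) * d              ≡⟨ cong (_* d) (K.+-identityʳ q (monoOf xs)) ⟩
    coeff q (monoOf xs) * d                      ≡⟨ first xs ⟩
    + lookup0 xs 0 * (χ (suc n) (suc k) xs * + (n !))
      ≡⟨ cong (λ a → + a * (χ (suc n) (suc k) xs * + (n !))) (ℕ.*-identityʳ (lookup0 xs 0)) ⟨
    + (lookup0 xs 0 ℕ.* 1) * (χ (suc n) (suc k) xs * + (n !)) ∎
  partial (suc N) = begin
    coeff (q +R (D≤ N p +R X∂ N p)) (monoOf xs) * d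
      ≡⟨ cong (_* d) (+R-assoc q (D≤ N p) (X∂ N p) (monoOf xs)) ⟨
    coeff ((q +R D≤ N p) +R X∂ N p) (monoOf xs) * d
      ≡⟨ cong (_* d) (coeff-++ (q +R D≤ N p) (X∂ N p) (monoOf xs)) ⟩
    (coeff (q +R D≤ N p) (monoOf xs) + coeff (X∂ N p) (monoOf xs)) * d
      ≡⟨ ℤ.*-distribʳ-+ d (coeff (q +R D≤ N p) (monoOf xs)) _ ⟩
    coeff (q +R D≤ N p) (monoOf xs) * d + coeff (X∂ N p) (monoOf xs) * d
      ≡⟨ cong₂ _+_ (partial N) (next N) ⟩
    + w * e + + l * e
      ≡⟨ ℤ.*-distribʳ-+ e (+ w) (+ l) ⟨
    (+ w + + l) * e
      ≡⟨ cong (_* e) (ℤ.pos-+ w l) ⟨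
    + (w ℕ.+ l) * e ∎
    where
    w = weight 1 (suc N) xs
    l = lookup0 xs (suc N) ℕ.* suc (suc N)
    e = χ (suc n) (suc k) xs * + (n !)

-- The closed form of the Bell polynomials

Σℤ : ∀ {T : Set} → (T → ℤ) → List T → ℤ
Σℤ g = foldr (λ t acc → g t + acc) (+ 0)

Σℤ-++ : ∀ {T : Set} (g : T → ℤ) xs ys → Σℤ g (xs ++ ys) ≡ Σℤ g xs + Σℤ g ys
Σℤ-++ g [] ys = sym (ℤ.+-identityˡ _)
Σℤ-++ g (x ∷ xs) ys = trans (cong (_+_ (g x)) (Σℤ-++ g xs ys)) (sym (ℤ.+-assoc (g x) _ _))

Σℤ-map : ∀ {T U : Set} (g : U → ℤ) (f : T → U) xs → Σℤ g (map f xs) ≡ Σℤ (λ t → g (f t)) xs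
Σℤ-map g f [] = refl
Σℤ-map g f (x ∷ xs) = cong (_+_ (g (f x))) (Σℤ-map g f xs)

Σℤ-concatMap : ∀ {T U : Set} (g : U → ℤ) (f : T → List U) xs →
  Σℤ g (concatMap f xs) ≡ Σℤ (λ t → Σℤ g (f t)) xs
Σℤ-concatMap g f [] = refl
Σℤ-concatMap g f (x ∷ xs) = trans (Σℤ-++ g (f x) (concatMap f xs)) (cong (_+_ (Σℤ g (f x))) (Σℤ-concatMap g f xs))

Σℤ-zero : ∀ {T : Set} (g : T → ℤ) → (∀ t → g t ≡ + 0) → ∀ xs → Σℤ g xs ≡ + 0
Σℤ-zero g h [] = refl
Σℤ-zero g h (x ∷ xs) = cong₂ _+_ (h x) (Σℤ-zero g h xs)

Σℤ-single : ∀ {T : Set} (g : T → ℤ) (f : ℕ → T) n r → r < n → (∀ s → ¬ s ≡ r → g (f s) ≡ + 0) →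
  Σℤ g (applyUpTo f n) ≡ g (f r)
Σℤ-single g f (suc n) zero h z = trans (cong (_+_ (g (f 0))) (tail n (λ s → f (suc s)) (λ s → z (suc s) (λ ()))))
  (ℤ.+-identityʳ _)
  where
  tail : ∀ n f → (∀ s → g (f s) ≡ + 0) → Σℤ g (applyUpTo f n) ≡ + 0
  tail zero f z = refl
  tail (suc n) f z = cong₂ _+_ (z 0) (tail n (λ s → f (suc s)) (λ s → z (suc s)))
Σℤ-single g f (suc n) (suc r) (s≤s h) z = trans
  (cong₂ _+_ (z 0 (λ ())) (Σℤ-single g (λ s → f (suc s)) n r h (λ s k → z (suc s) (λ e → k (ℕ.suc-injective e)))))
  (ℤ.+-identityˡ _)

Σℤ-tuples-suc : ∀ g N b → Σℤ g (tuples (suc N) b) ≡ Σℤ (λ r → Σℤ (λ rs → g (r ∷ rs)) (tuples N b)) (upTo (suc b))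
Σℤ-tuples-suc g N b = trans (Σℤ-concatMap g (λ r → map (r ∷_) (tuples N b)) (upTo (suc b)))
  (Σℤ-cong (λ r → Σℤ-map g (r ∷_) (tuples N b)) (upTo (suc b)))
  where
  Σℤ-cong : ∀ {T : Set} {g g' : T → ℤ} → (∀ t → g t ≡ g' t) → ∀ xs → Σℤ g xs ≡ Σℤ g' xs
  Σℤ-cong h [] = refl
  Σℤ-cong h (x ∷ xs) = cong₂ _+_ (h x) (Σℤ-cong h xs)

Σℤ-tuples-zero : ∀ g N b → (∀ t → length t ≡ N → g t ≡ + 0) → Σℤ g (tuples N b) ≡ + 0
Σℤ-tuples-zero g zero b h = cong (_+ + 0) (h [] refl)
Σℤ-tuples-zero g (suc N) b h = trans (Σℤ-tuples-suc g N b)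
  (Σℤ-zero _ (λ r → Σℤ-tuples-zero (λ rs → g (r ∷ rs)) N b (λ t k → h (r ∷ t) (cong suc k))) (upTo (suc b)))

-- `tuples N b` contains every list of length `N` with entries at most `b` exactly once, so a
-- summand supported at `t` is counted once.
Σℤ-tuples-single : ∀ g N b t → length t ≡ N → (∀ i → lookup0 t i ≤ b) →
  (∀ s → length s ≡ N → ¬ s ≡ t → g s ≡ + 0) → Σℤ g (tuples N b) ≡ g t
Σℤ-tuples-single g zero b [] l h z = ℤ.+-identityʳ _
Σℤ-tuples-single g (suc N) b (r ∷ t) l h z = begin
  Σℤ g (tuples (suc N) b)
    ≡⟨ Σℤ-tuples-suc g N b ⟩
  Σℤ (λ r → Σℤ (λ rs → g (r ∷ rs)) (tuples N b)) (upTo (suc b))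
    ≡⟨ Σℤ-single (λ r → Σℤ (λ rs → g (r ∷ rs)) (tuples N b)) (λ s → s) (suc b) r (s≤s (h 0))
         (λ s k → Σℤ-tuples-zero _ N b (λ u lu → z (s ∷ u) (cong suc lu) (λ e → k (∷-injectiveˡ e)))) ⟩
  Σℤ (λ rs → g (r ∷ rs)) (tuples N b)
    ≡⟨ Σℤ-tuples-single (λ rs → g (r ∷ rs)) N b t (ℕ.suc-injective l) (λ i → h (suc i))
         (λ s ls k → z (r ∷ s) (cong suc ls) (λ e → k (∷-injectiveʳ e))) ⟩
  g (r ∷ t) ∎

-- Exponent lists of monomials have arbitrary length, while `tuples` lists only those of one exact
-- length. Cutting off entries is harmless where they vanish, as `pad-≐` requires.
pad : ℕ → List ℕ → List ℕ
pad zero _ = []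
pad (suc N) [] = 0 ∷ pad N []
pad (suc N) (x ∷ xs) = x ∷ pad N xs

length-pad : ∀ N xs → length (pad N xs) ≡ N
length-pad zero xs = refl
length-pad (suc N) [] = cong suc (length-pad N [])
length-pad (suc N) (x ∷ xs) = cong suc (length-pad N xs)

pad-≐ : ∀ N xs → (∀ i → N ≤ i → lookup0 xs i ≡ 0) → pad N xs ≐ xs
pad-≐ zero xs h i = sym (h i z≤n)
pad-≐ (suc N) [] h zero = refl
pad-≐ (suc N) [] h (suc i) = pad-≐ N [] (λ _ _ → refl) i
pad-≐ (suc N) (x ∷ xs) h zero = refl
pad-≐ (suc N) (x ∷ xs) h (suc i) = pad-≐ N xs (λ j k → h (suc j) (s≤s k)) i

≐⇒≡ : ∀ xs ys → length xs ≡ length ys → xs ≐ ys → xs ≡ ys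
≐⇒≡ [] [] l h = refl
≐⇒≡ (x ∷ xs) (y ∷ ys) l h = cong₂ _∷_ (h 0) (≐⇒≡ xs ys (ℕ.suc-injective l) (λ i → h (suc i)))

lookup≤sumL : ∀ xs i → lookup0 xs i ≤ sumL xs
lookup≤sumL [] i = z≤n
lookup≤sumL (x ∷ xs) zero = ℕ.m≤m+n x (sumL xs)
lookup≤sumL (x ∷ xs) (suc i) = ℕ.≤-trans (lookup≤sumL xs i) (ℕ.m≤n+m (sumL xs) x)

wsum-lower : ∀ s xs → s ℕ.* sumL xs ≤ wsum s xs
wsum-lower s [] = ℕ.≤-reflexive (ℕ.*-zeroʳ s)
wsum-lower s (x ∷ xs) = ℕ.≤-trans (ℕ.≤-reflexive (ℕ.*-distribˡ-+ s x (sumL xs)))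
  (ℕ.+-monoʳ-≤ (s ℕ.* x) (ℕ.≤-trans (ℕ.m≤n+m (s ℕ.* sumL xs) (sumL xs)) (wsum-lower (suc s) xs)))

-- `wsum s xs` exceeds `s` times the sum of the entries by the sum of position times entry, and a
-- nonzero entry at position `i` contributes at least `i` to that.
wsum-lower-index : ∀ s xs i → ¬ lookup0 xs i ≡ 0 → s ℕ.* sumL xs ℕ.+ i ≤ wsum s xs
wsum-lower-index s [] i h = contradiction refl h
wsum-lower-index s (x ∷ xs) zero h = ℕ.≤-trans (ℕ.≤-reflexive (ℕ.+-identityʳ _)) (wsum-lower s (x ∷ xs))
wsum-lower-index s (x ∷ xs) (suc i) h = ℕ.≤-trans
  (ℕ.≤-reflexive (step s x (sumL xs) i))
  (ℕ.+-monoʳ-≤ (s ℕ.* x) (ℕ.≤-trans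
    (ℕ.+-monoˡ-≤ i (ℕ.+-monoˡ-≤ (s ℕ.* sumL xs) (ℕ.≤-trans (ℕ.n≢0⇒n>0 h) (lookup≤sumL xs i))))
    (wsum-lower-index (suc s) xs i h)))
  where
  step : ∀ s x t i → s ℕ.* (x ℕ.+ t) ℕ.+ suc i ≡ s ℕ.* x ℕ.+ (1 ℕ.+ s ℕ.* t ℕ.+ i)
  step = ℕ-Solver.solve-∀

-- A nonzero exponent at position `i`, that is, of `X (suc i)`, forces `k + i ≤ n`. Hence tuples of
-- length `n - k + 1` reach every nonzero exponent.
isBell-high : ∀ n k xs → sumL xs ≡ k → wsum 1 xs ≡ n → ∀ i → n ℕ.∸ k ℕ.+ 1 ≤ i → lookup0 xs i ≡ 0
isBell-high n k xs hs hw i h with lookup0 xs i ℕ.≟ 0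
... | yes z = z
... | no nz = contradiction (ℕ.≤-trans (ℕ.≤-reflexive (ℕ.+-comm 1 (n ℕ.∸ k))) h) (ℕ.≤⇒≯ i≤n∸k)
  where
  i≤n∸k : i ≤ n ℕ.∸ k
  i≤n∸k = ℕ.m+n≤o⇒m≤o∸n i (subst₂ _≤_ (ℕ.+-comm k i) hw
    (subst (λ t → t ℕ.+ i ≤ wsum 1 xs) (trans (ℕ.*-identityˡ _) hs) (wsum-lower-index 1 xs i nz)))

-- The integer `c` is itself the witness that `d` divides `n`, so the truncating division is exact.
-- A negative `c` would make the product negative.
quotient-unique : ∀ c d n .{{_ : ℕ.NonZero d}} → c * + d ≡ + n → c ≡ + (n / d)
quotient-unique (+ c) d n h = cong +_ (sym (trans (cong (_/ d) (sym (ℤ.+-injective (trans (ℤ.pos-* c d) h)))) (m*n/n≡m c d)))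
quotient-unique -[1+ c ] (suc d) n ()

bell-coeff-closed : ∀ n k xs → isBell n k xs ≡ true →
  coeff (bell n k) (monoOf xs) ≡ + ((n !) / denom 1 xs) {{denom≢0 1 xs}}
bell-coeff-closed n k xs h = quotient-unique (coeff (bell n k) (monoOf xs)) (denom 1 xs) (n !) {{denom≢0 1 xs}}
  (trans (bell-coeff n k xs) (trans (cong (λ b → (if b then + 1 else + 0) * + (n !)) h) (ℤ.*-identityˡ _)))

bell-coeff-zero : ∀ n k xs → isBell n k xs ≡ false → coeff (bell n k) (monoOf xs) ≡ + 0
bell-coeff-zero n k xs h = ℤ.*-cancelʳ-≡ _ (+ 0) (+ denom 1 xs) {{denom≢0 1 xs}}
  (trans (bell-coeff n k xs) (cong (λ b → (if b then + 1 else + 0) * + (n !)) h))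

coeff-bellSum : ∀ n (P : List ℕ → Bool) ts m →
  coeff (foldr (λ rs acc → bellTerm n rs +R acc) 0R (filterᵇ P ts)) m
    ≡ Σℤ (λ rs → if P rs then coeff (bellTerm n rs) m else + 0) ts
coeff-bellSum n P [] m = refl
coeff-bellSum n P (t ∷ ts) m with P t
... | true = trans (coeff-++ (bellTerm n t) (foldr (λ rs acc → bellTerm n rs +R acc) 0R (filterᵇ P ts)) m)
               (cong (_+_ (coeff (bellTerm n t) m)) (coeff-bellSum n P ts m))
... | false = trans (coeff-bellSum n P ts m) (sym (ℤ.+-identityˡ _))

coeff-bellTerm-other : ∀ n t m → ¬ monoOf t ≋ m → coeff (bellTerm n t) m ≡ + 0
coeff-bellTerm-other n t m h with sameMono (monoOf t) m | sameMono-reflects (monoOf t) m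
... | false | _ = refl
... | true | ofʸ k = contradiction k h

coeff-bellTerm-self : ∀ n t m → monoOf t ≋ m → coeff (bellTerm n t) m ≡ + ((n !) / denom 1 t) {{denom≢0 1 t}}
coeff-bellTerm-self n t m h with sameMono (monoOf t) m | sameMono-reflects (monoOf t) m
... | true | _ = ℤ.+-identityʳ _
... | false | ofⁿ k = contradiction h k

-- The coefficients agree at each monomial. With a negative exponent of `X 1` both vanish; if the
-- exponents satisfy the index conditions, exactly one tuple contributes, namely their padding;
-- otherwise none does, since the conditions do not depend on trailing zeros.
bellSum≈bell : ∀ n k →
  foldr (λ rs acc → bellTerm n rs +R acc) 0R (filterᵇ (isBell n k) (tuples (n ℕ.∸ k ℕ.+ 1) k)) ≈ bell n k
bellSum≈bell n k m@(mono -[1+ j ] es) =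
  trans (coeff-bellSum n (isBell n k) (tuples (n ℕ.∸ k ℕ.+ 1) k) m)
    (trans (Σℤ-zero _ term-zero (tuples (n ℕ.∸ k ℕ.+ 1) k)) (sym (bell-negative n k j es)))
  where
  e₁-nonneg : ∀ t → ¬ Mono.e₁ (monoOf t) ≡ -[1+ j ]
  e₁-nonneg t h with trans (sym (e₁-monoOf t)) h
  ... | ()
  term-zero : ∀ t → (if isBell n k t then coeff (bellTerm n t) m else + 0) ≡ + 0
  term-zero t with isBell n k t
  ... | true = coeff-bellTerm-other n t m (λ h → e₁-nonneg t (e₁-≡ h))
  ... | false = refl
bellSum≈bell n k (mono (+ r) es) = trans (coeff-bellSum n (isBell n k) (tuples N k) m) Σ≡bell
  where
  N = n ℕ.∸ k ℕ.+ 1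
  xs = r ∷ es
  m = monoOf xs
  g : List ℕ → ℤ
  g t = if isBell n k t then coeff (bellTerm n t) m else + 0
  g-zero : ∀ t → ¬ t ≐ xs → g t ≡ + 0
  g-zero t h with isBell n k t
  ... | true = coeff-bellTerm-other n t m (λ l → h (monoOf-injective t xs l))
  ... | false = refl
  g-isBell : ∀ t → isBell n k t ≡ true → t ≐ xs → g t ≡ coeff (bell n k) m
  g-isBell t b h = begin
    g t                                           ≡⟨ cong (λ b → if b then coeff (bellTerm n t) m else + 0) b ⟩
    coeff (bellTerm n t) m                        ≡⟨ coeff-bellTerm-self n t m (monoOf-cong t xs h) ⟩
    + ((n !) / denom 1 t) {{denom≢0 1 t}}         ≡⟨ bell-coeff-closed n k t b ⟨
    coeff (bell n k) (monoOf t)                   ≡⟨ coeff-cong (bell n k) (monoOf-cong t xs h) ⟩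
    coeff (bell n k) m                            ∎
  Σ≡bell : Σℤ g (tuples N k) ≡ coeff (bell n k) m
  Σ≡bell with isBell n k xs in eq | isBell-reflects n k xs
  ... | true | ofʸ (hs , hw) = trans
    (Σℤ-tuples-single g N k (pad N xs) (length-pad N xs)
      -- The entries sum to `k`, so each is at most `k`, the bound on entries in `tuples N k`.
      (λ i → subst₂ _≤_ (sym (t≐xs i)) hs (lookup≤sumL xs i))
      (λ s ls s≢t → g-zero s (λ h → s≢t (≐⇒≡ s (pad N xs) (trans ls (sym (length-pad N xs)))
        (λ i → trans (h i) (sym (t≐xs i)))))))
    (g-isBell (pad N xs) (trans (isBell-cong n k (pad N xs) xs t≐xs) eq) t≐xs)
    where
    t≐xs : pad N xs ≐ xs
    t≐xs = pad-≐ N xs (isBell-high n k xs hs hw)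
  ... | false | _ = trans (Σℤ-zero g all-zero (tuples N k)) (sym (bell-coeff-zero n k xs eq))
    where
    all-zero : ∀ t → g t ≡ + 0
    all-zero t with isBell n k t in eq'
    ... | false = refl
    ... | true = coeff-bellTerm-other n t m λ l →
      contradiction (trans (sym eq') (trans (isBell-cong n k t xs (monoOf-injective t xs l)) eq)) λ ()

B≈bell : ∀ n k → 1 ≤ k → k ≤ n → B n k ≈ bell n k
B≈bell (suc n) (suc k) _ k≤n with suc k ℕ.≤? suc n
... | yes _ = bellSum≈bell (suc n) (suc k)
... | no k≰n = contradiction k≤n k≰n

theorem5p3 : (n k : ℕ) → 1 ≤ k → k ≤ n →
    (A n k ≈ substR (B n k) (λ i → A i 1) (X 1) A₁₁-unit)
    × (B n k ≈ substR (A n k) (λ i → A i 1) (X 1) A₁₁-unit)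
theorem5p3 n k 1≤k k≤n =
  (λ m → sym (trans (Φ.φ-cong (B n k) (bell n k) B≈ m) (proj₁ (inversion n k) m))) ,
  (λ m → trans (B≈ m) (sym (proj₂ (inversion n k) m)))
  where
  B≈ : B n k ≈ bell n k
  B≈ = B≈bell n k 1≤k k≤n
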